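{- Let $n$ be large and let $B\ge \log n$ be an integer space parameter. Consider the following algorithm, run on a stream whose final frequency vector is the Zipfian vector $f\in\mathbb{R}^n$ with $f_i=1/i$ for all $i\in[n]$. Let $T=\Theta(\log\log n)$. The algorithm maintains $T$ independent CountSketch tables: $S_1,\dots,S_{T-1}$, each with $3$ rows and $\frac{B}{6T}$ columns, and $S_T$ with $3$ rows and $\frac{B}{6}$ columns; every stream update $(i,\Delta)$ is fed into all $T$ tables. To answer a query for $i\in[n]$, let $\hat f_i^{\,j}$ be the CountSketch estimate of $f_i$ from table $S_j$, and let $\tilde f_i=\mathrm{Median}(\hat f_i^{\,1},\dots,\hat f_i^{\,T-1})$. If $\tilde f_i<\tau$, where $\tau=\Theta(\log\log n)/B$, the algorithm outputs $\hat f_i=0$; otherwise it outputs $\hat f_i=\hat f_i^{\,T}$, the estimate of table $S_T$. Then, for suitable choices of the absolute constants hidden in $T=\Theta(\log\log n)$ and in $\tau$, the expected weighted error satisfies $$\mathbb{E}\left[\frac{1}{N}\sum_{i=1}^n f_i\,|f_i-\hat f_i|\right]=O\left(\frac{\log B+\mathrm{poly}(\log\log n)}{B\log n}\right),$$ where $N=\sum_{i=1}^n f_i$.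
   Context: A stream consists of updates $(i,\Delta)$ with $i\in[n]$, $\Delta\in\mathbb{R}$, and the final frequency vector $f$ has $f_i$ equal to the sum of updates to coordinate $i$. A CountSketch table with $k$ rows and $w$ columns uses independent, uniformly random hash functions $h_1,\dots,h_k:[n]\to[w]$ and sign functions $s_1,\dots,s_k:[n]\to\{ -1,1\}$, maintains $C[\ell,b]=\sum_{j\in[n]}[h_\ell(j)=b]\,s_\ell(j)f_j$ (where $[\cdot]$ is the indicator), and estimates $f_i$ by $\mathrm{median}_{\ell\in[k]}\, s_\ell(i)\,C[\ell,h_\ell(i)]$. The tables $S_1,\dots,S_T$ use independent randomness. The expectation is over the randomness of the hash and sign functions. -}

module Defs where

open import Data.Nat as ℕ using (ℕ; zero; suc; NonZero)
open import Data.Nat.Logarithm using (⌊log₂_⌋; ⌈log₂_⌉)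
open import Data.Integer using (+_; -_)
open import Data.Rational using (ℚ; 0ℚ; 1ℚ; _+_; _*_; _-_; ∣_∣; _<_; _/_)
open import Data.Rational.Properties using (_<?_; ≤-decTotalOrder)
open import Data.Fin using (Fin; zero; suc; toℕ)
open import Data.Fin.Properties using (_≟_)
open import Data.Bool using (Bool; true; false; if_then_else_)
open import Data.Vec using (Vec; []; _∷_; toList; init; last)
open import Data.List as List using (List; []; _∷_; length; drop; concatMap; map)
open import Data.Product using (_×_; _,_)
open import Relation.Nullary using (does)
open import Data.List.Sort ≤-decTotalOrder using (sort)

-- Finite uniform probability: expectation = average over an explicit
-- list enumerating all outcomes (each equally likely).

sumL : List ℚ → ℚ
sumL = List.foldr _+_ 0ℚ

ℕtoℚ : ℕ → ℚ
ℕtoℚ k = + k / 1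

Ex : {A : Set} → List A → (A → ℚ) → ℚ
Ex [] X = 0ℚ
Ex xs@(_ ∷ ys) X = sumL (map X xs) * (+ 1 / suc (length ys))

allFun : {B : Set} (n : ℕ) → List B → List (Fin n → B)
allFun zero bs = (λ ()) ∷ []
allFun (suc n) bs =
  concatMap (λ b → map (λ g → λ { zero → b ; (suc i) → g i }) (allFun n bs)) bs

allVec : {A : Set} (k : ℕ) → List A → List (Vec A k)
allVec zero as = [] ∷ []
allVec (suc k) as = concatMap (λ a → map (a ∷_) (allVec k as)) as

allFin : (w : ℕ) → List (Fin w)
allFin zero = []
allFin (suc w) = zero ∷ map suc (allFin w)

allPairs : {A B : Set} → List A → List B → List (A × B)
allPairs as bs = concatMap (λ a → map (a ,_) bs) as

sumFin : (n : ℕ) → (Fin n → ℚ) → ℚ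
sumFin zero g = 0ℚ
sumFin (suc n) g = g zero + sumFin n (λ i → g (suc i))

headOr0 : List ℚ → ℚ
headOr0 [] = 0ℚ
headOr0 (x ∷ _) = x

-- Median of a list: the element of rank ⌊(m-1)/2⌋ (0-based) in sorted
-- order, i.e. the lower median (the usual median when m is odd).
median : List ℚ → ℚ
median xs = headOr0 (drop (ℕ._/_ (length xs ℕ.∸ 1) 2) (sort xs))

sgn : Bool → ℚ
sgn true = 1ℚ
sgn false = + 0 / 1 - 1ℚ

-- one row of a CountSketch table: hash function and sign function
Row : ℕ → ℕ → Set
Row n w = (Fin n → Fin w) × (Fin n → Bool)

Table : ℕ → ℕ → Set
Table n w = Vec (Row n w) 3

-- all (equally likely) tables: independent uniform hashes and signs
allTables : (n w : ℕ) → List (Table n w)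
allTables n w =
  allVec 3 (allPairs (allFun n (allFin w)) (allFun n (true ∷ false ∷ [])))

counter : {n w : ℕ} → (Fin n → ℚ) → Row n w → Fin w → ℚ
counter {n} f (h , s) b =
  sumFin n (λ j → if does (h j ≟ b) then sgn (s j) * f j else 0ℚ)

rowEst : {n w : ℕ} → (Fin n → ℚ) → Row n w → Fin n → ℚ
rowEst f (h , s) i = sgn (s i) * counter f (h , s) (h i)

csEst : {n w : ℕ} → (Fin n → ℚ) → Table n w → Fin n → ℚ
csEst f S i = median (toList (Data.Vec.map (λ r → rowEst f r i) S))

-- Zipfian frequency vector f_i = 1/i, i ∈ [n]  (Fin index i ↦ i+1)
zipf : (n : ℕ) → Fin n → ℚ
zipf n i = + 1 / suc (toℕ i)

lglg : ℕ → ℕ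
lglg n = ⌊log₂ ⌊log₂ n ⌋ ⌋

numT : ℕ → ℕ → ℕ
numT cT n = suc (cT ℕ.* lglg n)

-- widths: ⌊B/(6T)⌋ for S_1..S_{T-1} and ⌊B/6⌋ for S_T
width₁ : ℕ → ℕ → ℕ → ℕ
width₁ cT n B = ℕ._/_ B (6 ℕ.* numT cT n)

width₂ : ℕ → ℕ
width₂ B = ℕ._/_ B 6

-- output of the algorithm on query i, given the T tables
-- (S_1..S_{T-1} as a vector of length T-1, and S_T), and threshold τ
algOut : (n : ℕ) (T w₁ w₂ : ℕ) (τ : ℚ) →
         Vec (Table n w₁) T → Table n w₂ → Fin n → ℚ
algOut n T w₁ w₂ τ Ss S i =
  let f = zipf n
      ftilde = median (toList (Data.Vec.map (λ S' → csEst f S' i) Ss))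
  in if does (ftilde <? τ) then 0ℚ else csEst f S i

tau : ℚ → ℕ → (B : ℕ) → .{{NonZero B}} → ℚ
tau cτ n B = cτ * ℕtoℚ (lglg n) * (+ 1 / B)

expWeightedErr : (cT : ℕ) (cτ : ℚ) (n B : ℕ) → .{{NonZero B}} → ℚ
expWeightedErr cT cτ n B =
  let T = numT cT n
      w₁ = width₁ cT n B
      w₂ = width₂ B
      f = zipf n
  in Ex (allVec (T ℕ.∸ 1) (allTables n w₁)) λ Ss →
     Ex (allTables n w₂) λ S →
     sumFin n (λ i → f i * ∣ f i - algOut n (T ℕ.∸ 1) w₁ w₂ (tau cτ n B) Ss S i ∣)

totalN : ℕ → ℚ
totalN n = sumFin n (zipf n)

{-# OPTIONS --safe #-}
module Submission where

-- Let X_r be the error of row r of a table with w columns, for a fixed item i.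
-- Items of rank at most w contribute to X_r at most A = Σ [h j = h i] f_j, and
-- the others a signed sum Z with E Z² ≤ 1/w², so X_r ≤ A + |Z|.  Since min is
-- subadditive, two independent rows satisfy
--   E min(A, A′) ≤ w⁻² Σ_{j,l ≤ w} min(f_j, f_l) ≤ 2/w,
-- hence E min(X₁, X₂) ≤ 6/w, and as a median of three errs by at most the second
-- largest error, the expected error of a table is O(1/w).
--
-- Write e_a for the error of table a, ℓ = log log n and T for the number of tables.
-- If item i is zeroed, two tables have τ + e_a ≥ f_i, so
-- f_i² ≤ Σ_{a<b} (τ + e_a)(τ + e_b), which has expectation O(T² ℓ²/B²); over the
-- items i ≤ B this sums to O(ℓ⁴/B).  If i > B is not zeroed, half of the tables
-- err by about τ, so 1 ≤ Π (1/4 + κ e_a) for a suitable κ, a product of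
-- expectation at most 2^(1-T) = O(1/log n).  What remains is Σ_{i ≤ B} f_i · O(1/B) and
-- Σ_{i > B} f_i² ≤ 1/B.

open import Defs
open import Data.Nat as ℕ using (ℕ; zero; suc; NonZero; _^_; z≤n; s≤s)
import Data.Nat.Properties as ℕₚ
import Data.Nat.DivMod as DivMod
open import Data.Nat.Logarithm
import Data.Nat
import Data.Integer as ℤ
import Data.Integer.Properties as ℤₚ
open import Data.Rational hiding (NonZero)
open import Data.Rational.Properties
import Data.Rational
import Data.Rational.Unnormalised as ℚᵘ
import Data.Rational.Unnormalised.Properties as ℚᵘₚ
open import Data.Fin using (Fin; zero; suc; toℕ)
import Data.Fin.Properties as Finₚ
open import Data.Bool using (Bool; true; false; if_then_else_; T)
open import Data.Vec as Vec using (Vec; []; _∷_; toList)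
import Data.Vec.Properties as Vecₚ
open import Data.List as List using (List; []; _∷_; length; drop; filter; concatMap; map; _++_)
import Data.List.Properties as Listₚ
open import Data.List.Relation.Unary.All using (All; []; _∷_)
open import Data.List.Relation.Unary.AllPairs using (AllPairs; []; _∷_)
import Data.List.Relation.Unary.Linked.Properties as Linkedₚ
open import Data.List.Relation.Binary.Permutation.Propositional using (_↭_)
open import Data.List.Relation.Binary.Permutation.Propositional.Properties using (filter-↭; ↭-length)
open import Data.List.Sort ≤-decTotalOrder using (sort; sort-↭; sort-↗)
open import Data.Product using (Σ; _×_; _,_; proj₁)
open import Data.Sum using (inj₁; inj₂)
open import Data.Empty using (⊥-elim)
open import Data.Maybe.Base using (just; nothing)
open import Function using (_∘_)
open import Level using (0ℓ)
open import Relation.Nullary using (Dec; does; yes; no; ¬_)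
open import Relation.Nullary.Decidable using (toWitness; dec-true)
open import Relation.Unary using (Pred; Decidable)
open import Relation.Binary.PropositionalEquality
open import Tactic.RingSolver using (solve-∀)
import Tactic.RingSolver.Core.AlmostCommutativeRing as ACR

-- The target has `log B` to the first power, plus a term in log log n, and this shapes every
-- estimate. The head noise `A` of one row has expectation of order log w / w, because the
-- frequencies of rank at most w sum to about log w; weighted by `f_i` and summed over i ≤ B, this
-- would cost log² B. The minimum over two rows removes the logarithm: min(1/j, 1/l) = 1/max(j, l)
-- has double sum O(w), not log² w. For zeroed items, one table would only give f_i² ≤ f_i · Σ (τ +
-- e_a), whose sum over i ≤ B is log B times a power of ℓ. Two tables give a bound free of `f_i`,
-- which is simply multiplied by the number of items. The table error is controlled in expectation
-- only. Hence both uses of several tables are products over distinct, independent tables, affine in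
-- each error. For items beyond B such a product replaces a Chernoff bound: every factor has mean at
-- most 1/2, yet the product is at least 1 whenever half of the tables are bad.

private variable A B C : Set

ℚ-ring : ACR.AlmostCommutativeRing 0ℓ 0ℓ
ℚ-ring = ACR.fromCommutativeRing +-*-commutativeRing 0≟
  where
  0≟ : ∀ x → _
  0≟ x with 0ℚ ≟ x
  ... | yes p = just p
  ... | no _ = nothing

-- Inequalities in the ordered field of rationals

0≤1 : 0ℚ ≤ 1ℚ
0≤1 = nonNegative⁻¹ 1ℚ

+-nonneg : ∀ {p q} → 0ℚ ≤ p → 0ℚ ≤ q → 0ℚ ≤ p + q
+-nonneg p≥0 q≥0 = +-mono-≤ p≥0 q≥0

*-monoˡ : ∀ {r p q} → 0ℚ ≤ r → p ≤ q → r * p ≤ r * q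
*-monoˡ {r} r≥0 = *-monoˡ-≤-nonNeg r {{nonNegative r≥0}}

*-monoʳ : ∀ {r p q} → 0ℚ ≤ r → p ≤ q → p * r ≤ q * r
*-monoʳ {r} r≥0 = *-monoʳ-≤-nonNeg r {{nonNegative r≥0}}

*-nonneg : ∀ {p q} → 0ℚ ≤ p → 0ℚ ≤ q → 0ℚ ≤ p * q
*-nonneg {p} p≥0 q≥0 = ≤-trans (≤-reflexive (sym (*-zeroʳ p))) (*-monoˡ p≥0 q≥0)

*-mono : ∀ {p q r s} → 0ℚ ≤ p → 0ℚ ≤ s → p ≤ q → r ≤ s → p * r ≤ q * s
*-mono p≥0 s≥0 p≤q r≤s = ≤-trans (*-monoˡ p≥0 r≤s) (*-monoʳ s≥0 p≤q)

p≤p+q : ∀ {p q} → 0ℚ ≤ q → p ≤ p + q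
p≤p+q {p} q≥0 = ≤-trans (≤-reflexive (sym (+-identityʳ p))) (+-monoʳ-≤ p q≥0)

p≤q+p : ∀ {p q} → 0ℚ ≤ q → p ≤ q + p
p≤q+p {p} q≥0 = ≤-trans (≤-reflexive (sym (+-identityˡ p))) (+-monoˡ-≤ p q≥0)

0≤q-p : ∀ {p q} → p ≤ q → 0ℚ ≤ q - p
0≤q-p {p} p≤q = ≤-trans (≤-reflexive (sym (+-inverseʳ p))) (+-monoˡ-≤ (- p) p≤q)

≤-by : ∀ {p q d} → 0ℚ ≤ d → q ≡ p + d → p ≤ q
≤-by d≥0 refl = p≤p+q d≥0

p≤∣p∣ : ∀ p → p ≤ ∣ p ∣
p≤∣p∣ p with ≤-total 0ℚ p
... | inj₁ 0≤p = ≤-reflexive (sym (0≤p⇒∣p∣≡p 0≤p))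
... | inj₂ p≤0 = ≤-trans p≤0 (0≤∣p∣ p)

sq-nonneg : ∀ p → 0ℚ ≤ p * p
sq-nonneg p with ≤-total 0ℚ p
... | inj₁ 0≤p = *-nonneg 0≤p 0≤p
... | inj₂ p≤0 = ≤-trans (*-nonneg (neg-antimono-≤ p≤0) (neg-antimono-≤ p≤0)) (≤-reflexive (lem p))
  where
  lem : ∀ p → (- p) * (- p) ≡ p * p
  lem = solve-∀ ℚ-ring

⊓-nonneg : ∀ {p q} → 0ℚ ≤ p → 0ℚ ≤ q → 0ℚ ≤ p ⊓ q
⊓-nonneg = ⊓-glb

-- Natural numbers and their reciprocals as rationals

fromℚᵘ-homo-+ : ∀ p q → fromℚᵘ p + fromℚᵘ q ≡ fromℚᵘ (p ℚᵘ.+ q)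
fromℚᵘ-homo-+ p q = toℚᵘ-injective
  (ℚᵘₚ.≃-trans (toℚᵘ-homo-+ (fromℚᵘ p) (fromℚᵘ q))
    (ℚᵘₚ.≃-trans (ℚᵘₚ.+-cong (toℚᵘ-fromℚᵘ p) (toℚᵘ-fromℚᵘ q)) (ℚᵘₚ.≃-sym (toℚᵘ-fromℚᵘ (p ℚᵘ.+ q)))))

fromℚᵘ-homo-* : ∀ p q → fromℚᵘ p * fromℚᵘ q ≡ fromℚᵘ (p ℚᵘ.* q)
fromℚᵘ-homo-* p q = toℚᵘ-injective
  (ℚᵘₚ.≃-trans (toℚᵘ-homo-* (fromℚᵘ p) (fromℚᵘ q))
    (ℚᵘₚ.≃-trans (ℚᵘₚ.*-cong (toℚᵘ-fromℚᵘ p) (toℚᵘ-fromℚᵘ q)) (ℚᵘₚ.≃-sym (toℚᵘ-fromℚᵘ (p ℚᵘ.* q)))))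

ℕtoℚ-suc : ∀ k → ℕtoℚ (suc k) ≡ 1ℚ + ℕtoℚ k
ℕtoℚ-suc k = sym (trans (fromℚᵘ-homo-+ ℚᵘ.1ℚᵘ (ℚᵘ.mkℚᵘ (ℤ.+ k) 0))
  (fromℚᵘ-cong {ℚᵘ.1ℚᵘ ℚᵘ.+ ℚᵘ.mkℚᵘ (ℤ.+ k) 0} {ℚᵘ.mkℚᵘ (ℤ.+ suc k) 0}
    (ℚᵘ.*≡* (cong (λ z → (ℤ.+ 1 ℤ.+ z) ℤ.* ℤ.+ 1) (ℤₚ.*-identityʳ (ℤ.+ k))))))

ℕtoℚ-+ : ∀ a b → ℕtoℚ (a ℕ.+ b) ≡ ℕtoℚ a + ℕtoℚ b
ℕtoℚ-+ zero b = sym (+-identityˡ (ℕtoℚ b))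
ℕtoℚ-+ (suc a) b = trans (ℕtoℚ-suc (a ℕ.+ b)) (trans (cong (1ℚ +_) (ℕtoℚ-+ a b))
  (trans (sym (+-assoc 1ℚ (ℕtoℚ a) (ℕtoℚ b))) (cong (_+ ℕtoℚ b) (sym (ℕtoℚ-suc a)))))

ℕtoℚ-* : ∀ a b → ℕtoℚ (a ℕ.* b) ≡ ℕtoℚ a * ℕtoℚ b
ℕtoℚ-* zero b = sym (*-zeroˡ (ℕtoℚ b))
ℕtoℚ-* (suc a) b = trans (ℕtoℚ-+ b (a ℕ.* b)) (trans (cong (ℕtoℚ b +_) (ℕtoℚ-* a b))
  (trans (lem (ℕtoℚ a) (ℕtoℚ b)) (cong (_* ℕtoℚ b) (sym (ℕtoℚ-suc a)))))
  where
  lem : ∀ x y → y + x * y ≡ (1ℚ + x) * y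
  lem = solve-∀ ℚ-ring

0≤ℕtoℚ : ∀ k → 0ℚ ≤ ℕtoℚ k
0≤ℕtoℚ k = nonNegative⁻¹ (ℕtoℚ k) {{normalize-nonNeg k 1}}

ℕtoℚ-mono : ∀ {a b} → a ℕ.≤ b → ℕtoℚ a ≤ ℕtoℚ b
ℕtoℚ-mono {a} {b} a≤b = ≤-by (0≤ℕtoℚ (b ℕ.∸ a))
  (trans (cong ℕtoℚ (sym (ℕₚ.m+[n∸m]≡n a≤b))) (ℕtoℚ-+ a (b ℕ.∸ a)))

-- The junk value inv 0 = 0 makes inv multiplicative on all of ℕ.
inv : ℕ → ℚ
inv zero = 0ℚ
inv (suc k) = ℤ.+ 1 / suc k

0≤inv : ∀ k → 0ℚ ≤ inv k
0≤inv zero = ≤-refl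
0≤inv (suc k) = nonNegative⁻¹ (inv (suc k)) {{normalize-nonNeg 1 (suc k)}}

ℕtoℚ*inv : ∀ k .{{_ : NonZero k}} → ℕtoℚ k * inv k ≡ 1ℚ
ℕtoℚ*inv (suc k) = trans (fromℚᵘ-homo-* (ℚᵘ.mkℚᵘ (ℤ.+ suc k) 0) (ℚᵘ.mkℚᵘ (ℤ.+ 1) k))
  (fromℚᵘ-cong {ℚᵘ.mkℚᵘ (ℤ.+ suc k) 0 ℚᵘ.* ℚᵘ.mkℚᵘ (ℤ.+ 1) k} {ℚᵘ.1ℚᵘ}
    (ℚᵘ.*≡* (trans (cong (ℤ._* ℤ.+ 1) (ℤₚ.*-identityʳ (ℤ.+ suc k)))
      (trans (ℤₚ.*-comm (ℤ.+ suc k) (ℤ.+ 1))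
        (cong (λ z → ℤ.+ 1 ℤ.* ℤ.+ z) (sym (ℕₚ.*-identityˡ (suc k))))))))

ℕtoℚ*inv≤1 : ∀ k → ℕtoℚ k * inv k ≤ 1ℚ
ℕtoℚ*inv≤1 zero = ≤-trans (≤-reflexive (*-zeroˡ (inv 0))) 0≤1
ℕtoℚ*inv≤1 (suc k) = ≤-reflexive (ℕtoℚ*inv (suc k))

inv-unique : ∀ k .{{_ : NonZero k}} {p} → ℕtoℚ k * p ≡ 1ℚ → p ≡ inv k
inv-unique k {p} kp≡1 = begin
  p                       ≡⟨ sym (*-identityʳ p) ⟩
  p * 1ℚ                  ≡⟨ cong (p *_) (sym (ℕtoℚ*inv k)) ⟩
  p * (ℕtoℚ k * inv k)    ≡⟨ lem p (ℕtoℚ k) (inv k) ⟩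
  ℕtoℚ k * p * inv k      ≡⟨ cong (_* inv k) kp≡1 ⟩
  1ℚ * inv k              ≡⟨ *-identityˡ (inv k) ⟩
  inv k                   ∎
  where
  open ≡-Reasoning
  lem : ∀ p k i → p * (k * i) ≡ k * p * i
  lem = solve-∀ ℚ-ring

inv-* : ∀ a b → inv (a ℕ.* b) ≡ inv a * inv b
inv-* zero b = sym (*-zeroˡ (inv b))
inv-* (suc a) zero = trans (cong inv (ℕₚ.*-zeroʳ a)) (sym (*-zeroʳ (inv (suc a))))
inv-* (suc a) (suc b) = sym (inv-unique (suc a ℕ.* suc b) (begin
  ℕtoℚ (suc a ℕ.* suc b) * (inv (suc a) * inv (suc b))
    ≡⟨ cong (_* (inv (suc a) * inv (suc b))) (ℕtoℚ-* (suc a) (suc b)) ⟩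
  ℕtoℚ (suc a) * ℕtoℚ (suc b) * (inv (suc a) * inv (suc b))
    ≡⟨ lem (ℕtoℚ (suc a)) (ℕtoℚ (suc b)) (inv (suc a)) (inv (suc b)) ⟩
  (ℕtoℚ (suc a) * inv (suc a)) * (ℕtoℚ (suc b) * inv (suc b))
    ≡⟨ cong₂ _*_ (ℕtoℚ*inv (suc a)) (ℕtoℚ*inv (suc b)) ⟩
  1ℚ * 1ℚ ≡⟨⟩
  1ℚ ∎))
  where
  open ≡-Reasoning
  lem : ∀ x y u v → x * y * (u * v) ≡ (x * u) * (y * v)
  lem = solve-∀ ℚ-ring

cancelˡ : ∀ k .{{_ : NonZero k}} {p q} → ℕtoℚ k * p ≤ ℕtoℚ k * q → p ≤ q
cancelˡ k {p} {q} kp≤kq = subst₂ _≤_ (lem p) (lem q) (*-monoˡ (0≤inv k) kp≤kq)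
  where
  lem : ∀ x → inv k * (ℕtoℚ k * x) ≡ x
  lem x = trans (sym (*-assoc (inv k) (ℕtoℚ k) x))
    (trans (cong (_* x) (trans (*-comm (inv k) (ℕtoℚ k)) (ℕtoℚ*inv k))) (*-identityˡ x))

-- Finite sums

sumFin-cong : ∀ n {f g : Fin n → ℚ} → (∀ i → f i ≡ g i) → sumFin n f ≡ sumFin n g
sumFin-cong zero f≡g = refl
sumFin-cong (suc n) f≡g = cong₂ _+_ (f≡g zero) (sumFin-cong n (f≡g ∘ suc))

sumFin-mono : ∀ n {f g : Fin n → ℚ} → (∀ i → f i ≤ g i) → sumFin n f ≤ sumFin n g
sumFin-mono zero f≤g = ≤-refl
sumFin-mono (suc n) f≤g = +-mono-≤ (f≤g zero) (sumFin-mono n (f≤g ∘ suc))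

sumFin-zero : ∀ n → sumFin n (λ _ → 0ℚ) ≡ 0ℚ
sumFin-zero zero = refl
sumFin-zero (suc n) = trans (+-identityˡ _) (sumFin-zero n)

sumFin-nonneg : ∀ n {f : Fin n → ℚ} → (∀ i → 0ℚ ≤ f i) → 0ℚ ≤ sumFin n f
sumFin-nonneg n f≥0 = ≤-trans (≤-reflexive (sym (sumFin-zero n))) (sumFin-mono n f≥0)

+-interchange : ∀ a b c d → (a + b) + (c + d) ≡ (a + c) + (b + d)
+-interchange = solve-∀ ℚ-ring

sumFin-+ : ∀ n (f g : Fin n → ℚ) → sumFin n (λ i → f i + g i) ≡ sumFin n f + sumFin n g
sumFin-+ zero f g = refl
sumFin-+ (suc n) f g = trans (cong (f zero + g zero +_) (sumFin-+ n (f ∘ suc) (g ∘ suc)))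
  (+-interchange (f zero) (g zero) _ _)

sumFin-*ˡ : ∀ n c (f : Fin n → ℚ) → sumFin n (λ i → c * f i) ≡ c * sumFin n f
sumFin-*ˡ zero c f = sym (*-zeroʳ c)
sumFin-*ˡ (suc n) c f = trans (cong (c * f zero +_) (sumFin-*ˡ n c (f ∘ suc)))
  (sym (*-distribˡ-+ c (f zero) _))

sumFin-*ʳ : ∀ n c (f : Fin n → ℚ) → sumFin n (λ i → f i * c) ≡ sumFin n f * c
sumFin-*ʳ n c f = trans (sumFin-cong n (λ i → *-comm (f i) c))
  (trans (sumFin-*ˡ n c f) (*-comm c (sumFin n f)))

sumFin-swap : ∀ m n (f : Fin m → Fin n → ℚ) →
  sumFin m (λ i → sumFin n (f i)) ≡ sumFin n (λ j → sumFin m (λ i → f i j))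
sumFin-swap zero n f = sym (sumFin-zero n)
sumFin-swap (suc m) n f = trans (cong (sumFin n (f zero) +_) (sumFin-swap m n (f ∘ suc)))
  (sym (sumFin-+ n (f zero) (λ j → sumFin m (λ i → f (suc i) j))))

∣sumFin∣≤ : ∀ n (f : Fin n → ℚ) → ∣ sumFin n f ∣ ≤ sumFin n (λ i → ∣ f i ∣)
∣sumFin∣≤ zero f = ≤-refl
∣sumFin∣≤ (suc n) f = ≤-trans (∣p+q∣≤∣p∣+∣q∣ (f zero) _) (+-monoʳ-≤ ∣ f zero ∣ (∣sumFin∣≤ n (f ∘ suc)))

sumFin-extract : ∀ n (i : Fin n) (f : Fin n → ℚ) →
  sumFin n f ≡ f i + sumFin n (λ j → if does (j Finₚ.≟ i) then 0ℚ else f j)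
sumFin-extract (suc n) zero f = cong (f zero +_) (sym (+-identityˡ _))
sumFin-extract (suc n) (suc i) f = trans (cong (f zero +_) (sumFin-extract n i (f ∘ suc)))
  (lem (f zero) (f (suc i)) _)
  where
  lem : ∀ a b c → a + (b + c) ≡ b + (a + c)
  lem = solve-∀ ℚ-ring

𝟙 : Bool → ℚ
𝟙 b = if b then 1ℚ else 0ℚ

0≤𝟙 : ∀ b → 0ℚ ≤ 𝟙 b
0≤𝟙 true = 0≤1
0≤𝟙 false = ≤-refl

sumFin-𝟙≟ˡ : ∀ w (b : Fin w) → sumFin w (λ c → 𝟙 (does (c Finₚ.≟ b))) ≤ 1ℚ
sumFin-𝟙≟ˡ (suc w) zero = ≤-reflexive (cong (1ℚ +_) (sumFin-zero w))
sumFin-𝟙≟ˡ (suc w) (suc b) = ≤-trans (≤-reflexive (+-identityˡ _)) (sumFin-𝟙≟ˡ w b)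

sumFin-𝟙≟ʳ : ∀ w (b : Fin w) → sumFin w (λ c → 𝟙 (does (b Finₚ.≟ c))) ≤ 1ℚ
sumFin-𝟙≟ʳ (suc w) zero = ≤-reflexive (cong (1ℚ +_) (sumFin-zero w))
sumFin-𝟙≟ʳ (suc w) (suc b) = ≤-trans (≤-reflexive (+-identityˡ _)) (sumFin-𝟙≟ʳ w b)

-- Expectations

sumOver : List A → (A → ℚ) → ℚ
sumOver as X = sumL (map X as)

Ex≡ : (as : List A) (X : A → ℚ) → Ex as X ≡ sumOver as X * inv (length as)
Ex≡ [] X = refl
Ex≡ (a ∷ as) X = refl

sumOver-mono : (as : List A) {X Y : A → ℚ} → (∀ a → X a ≤ Y a) → sumOver as X ≤ sumOver as Y
sumOver-mono [] X≤Y = ≤-refl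
sumOver-mono (a ∷ as) X≤Y = +-mono-≤ (X≤Y a) (sumOver-mono as X≤Y)

sumOver-+ : (as : List A) (X Y : A → ℚ) → sumOver as (λ a → X a + Y a) ≡ sumOver as X + sumOver as Y
sumOver-+ [] X Y = refl
sumOver-+ (a ∷ as) X Y = trans (cong (X a + Y a +_) (sumOver-+ as X Y)) (+-interchange (X a) (Y a) _ _)

sumOver-*ˡ : (as : List A) (c : ℚ) (X : A → ℚ) → sumOver as (λ a → c * X a) ≡ c * sumOver as X
sumOver-*ˡ [] c X = sym (*-zeroʳ c)
sumOver-*ˡ (a ∷ as) c X = trans (cong (c * X a +_) (sumOver-*ˡ as c X)) (sym (*-distribˡ-+ c (X a) _))

sumOver-const : (as : List A) (c : ℚ) → sumOver as (λ _ → c) ≡ ℕtoℚ (length as) * c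
sumOver-const [] c = sym (*-zeroˡ c)
sumOver-const (a ∷ as) c = trans (cong (c +_) (sumOver-const as c))
  (trans (lem c (ℕtoℚ (length as))) (cong (_* c) (sym (ℕtoℚ-suc (length as)))))
  where
  lem : ∀ c k → c + k * c ≡ (1ℚ + k) * c
  lem = solve-∀ ℚ-ring

sumOver-++ : (as bs : List A) (X : A → ℚ) → sumOver (as ++ bs) X ≡ sumOver as X + sumOver bs X
sumOver-++ [] bs X = sym (+-identityˡ _)
sumOver-++ (a ∷ as) bs X = trans (cong (X a +_) (sumOver-++ as bs X)) (sym (+-assoc (X a) _ _))

sumOver-map : (as : List A) (g : A → B) (X : B → ℚ) → sumOver (map g as) X ≡ sumOver as (X ∘ g)
sumOver-map as g X = cong sumL (sym (Listₚ.map-∘ as))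

sumOver-product : (g : A → B → C) (as : List A) (bs : List B) (X : C → ℚ) →
  sumOver (concatMap (λ a → map (g a) bs) as) X ≡ sumOver as (λ a → sumOver bs (λ b → X (g a b)))
sumOver-product g [] bs X = refl
sumOver-product g (a ∷ as) bs X = trans (sumOver-++ (map (g a) bs) _ X)
  (cong₂ _+_ (sumOver-map bs (g a) X) (sumOver-product g as bs X))

length-product : (g : A → B → C) (as : List A) (bs : List B) →
  length (concatMap (λ a → map (g a) bs) as) ≡ length as ℕ.* length bs
length-product g [] bs = refl
length-product g (a ∷ as) bs = trans (Listₚ.length-++ (map (g a) bs))
  (cong₂ ℕ._+_ (Listₚ.length-map (g a) bs) (length-product g as bs))

Ex-mono : (as : List A) {X Y : A → ℚ} → (∀ a → X a ≤ Y a) → Ex as X ≤ Ex as Y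
Ex-mono as {X} {Y} X≤Y = subst₂ _≤_ (sym (Ex≡ as X)) (sym (Ex≡ as Y))
  (*-monoʳ (0≤inv (length as)) (sumOver-mono as X≤Y))

Ex-cong : (as : List A) {X Y : A → ℚ} → (∀ a → X a ≡ Y a) → Ex as X ≡ Ex as Y
Ex-cong as X≡Y = ≤-antisym (Ex-mono as (≤-reflexive ∘ X≡Y)) (Ex-mono as (≤-reflexive ∘ sym ∘ X≡Y))

Ex-+ : (as : List A) (X Y : A → ℚ) → Ex as (λ a → X a + Y a) ≡ Ex as X + Ex as Y
Ex-+ as X Y = begin
  Ex as (λ a → X a + Y a)                         ≡⟨ Ex≡ as _ ⟩
  sumOver as (λ a → X a + Y a) * inv (length as)  ≡⟨ cong (_* inv (length as)) (sumOver-+ as X Y) ⟩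
  (sumOver as X + sumOver as Y) * inv (length as) ≡⟨ *-distribʳ-+ (inv (length as)) (sumOver as X) (sumOver as Y) ⟩
  sumOver as X * inv (length as) + sumOver as Y * inv (length as)
                                                  ≡⟨ sym (cong₂ _+_ (Ex≡ as X) (Ex≡ as Y)) ⟩
  Ex as X + Ex as Y ∎
  where open ≡-Reasoning

Ex-*ˡ : (as : List A) (c : ℚ) (X : A → ℚ) → Ex as (λ a → c * X a) ≡ c * Ex as X
Ex-*ˡ as c X = begin
  Ex as (λ a → c * X a)                        ≡⟨ Ex≡ as _ ⟩
  sumOver as (λ a → c * X a) * inv (length as) ≡⟨ cong (_* inv (length as)) (sumOver-*ˡ as c X) ⟩
  c * sumOver as X * inv (length as)           ≡⟨ *-assoc c _ _ ⟩
  c * (sumOver as X * inv (length as))         ≡⟨ cong (c *_) (sym (Ex≡ as X)) ⟩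
  c * Ex as X ∎
  where open ≡-Reasoning

Ex-*ʳ : (as : List A) (c : ℚ) (X : A → ℚ) → Ex as (λ a → X a * c) ≡ Ex as X * c
Ex-*ʳ as c X = trans (Ex-cong as (λ a → *-comm (X a) c)) (trans (Ex-*ˡ as c X) (*-comm c _))

-- Only an inequality, because the average over an empty list is 0.
Ex-const≤ : (as : List A) {c : ℚ} → 0ℚ ≤ c → Ex as (λ _ → c) ≤ c
Ex-const≤ as {c} c≥0 = begin
  Ex as (λ _ → c)                            ≡⟨ Ex≡ as _ ⟩
  sumOver as (λ _ → c) * inv (length as)     ≡⟨ cong (_* inv (length as)) (sumOver-const as c) ⟩
  ℕtoℚ (length as) * c * inv (length as)     ≡⟨ lem (ℕtoℚ (length as)) c _ ⟩
  c * (ℕtoℚ (length as) * inv (length as))   ≤⟨ *-monoˡ c≥0 (ℕtoℚ*inv≤1 (length as)) ⟩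
  c * 1ℚ                                     ≡⟨ *-identityʳ c ⟩
  c ∎
  where
  open ≤-Reasoning
  lem : ∀ k c i → k * c * i ≡ c * (k * i)
  lem = solve-∀ ℚ-ring

Ex-≤const : (as : List A) {X : A → ℚ} {c : ℚ} → 0ℚ ≤ c → (∀ a → X a ≤ c) → Ex as X ≤ c
Ex-≤const as c≥0 X≤c = ≤-trans (Ex-mono as X≤c) (Ex-const≤ as c≥0)

Ex-zero : (as : List A) → Ex as (λ _ → 0ℚ) ≡ 0ℚ
Ex-zero as = trans (Ex-*ˡ as 0ℚ (λ _ → 0ℚ)) (*-zeroˡ (Ex as (λ _ → 0ℚ)))

Ex-nonneg : (as : List A) {X : A → ℚ} → (∀ a → 0ℚ ≤ X a) → 0ℚ ≤ Ex as X
Ex-nonneg as X≥0 = ≤-trans (≤-reflexive (sym (Ex-zero as))) (Ex-mono as X≥0)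

Ex-sumFin : (as : List A) (n : ℕ) (X : Fin n → A → ℚ) →
  Ex as (λ a → sumFin n (λ i → X i a)) ≡ sumFin n (λ i → Ex as (X i))
Ex-sumFin as zero X = Ex-zero as
Ex-sumFin as (suc n) X = trans (Ex-+ as (X zero) _) (cong (Ex as (X zero) +_) (Ex-sumFin as n (X ∘ suc)))

-- All independence enters here: rows, tables, hashes and signs are all enumerated by such a
-- `concatMap`, so expectations become iterated. The identity survives empty lists because `inv` is
-- multiplicative at 0 too.
Ex-product : (g : A → B → C) (as : List A) (bs : List B) (X : C → ℚ) →
  Ex (concatMap (λ a → map (g a) bs) as) X ≡ Ex as (λ a → Ex bs (λ b → X (g a b)))
Ex-product g as bs X = begin
  Ex cs X
    ≡⟨ Ex≡ cs X ⟩
  sumOver cs X * inv (length cs)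
    ≡⟨ cong₂ (λ x k → x * inv k) (sumOver-product g as bs X) (length-product g as bs) ⟩
  S * inv (length as ℕ.* length bs)
    ≡⟨ cong (S *_) (inv-* (length as) (length bs)) ⟩
  S * (inv (length as) * inv (length bs))
    ≡⟨ lem S (inv (length as)) (inv (length bs)) ⟩
  inv (length bs) * S * inv (length as)
    ≡⟨ cong (_* inv (length as)) (sym (sumOver-*ˡ as (inv (length bs)) _)) ⟩
  sumOver as (λ a → inv (length bs) * sumOver bs (X ∘ g a)) * inv (length as)
    ≡⟨ sym (Ex≡ as _) ⟩
  Ex as (λ a → inv (length bs) * sumOver bs (X ∘ g a))
    ≡⟨ Ex-cong as (λ a → trans (*-comm (inv (length bs)) _) (sym (Ex≡ bs (X ∘ g a)))) ⟩
  Ex as (λ a → Ex bs (X ∘ g a)) ∎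
  where
  open ≡-Reasoning
  cs = concatMap (λ a → map (g a) bs) as
  S = sumOver as (λ a → sumOver bs (X ∘ g a))
  lem : ∀ s i j → s * (i * j) ≡ j * s * i
  lem = solve-∀ ℚ-ring

Ex-allVec : (k : ℕ) (as : List A) (X : Vec A (suc k) → ℚ) →
  Ex (allVec (suc k) as) X ≡ Ex as (λ a → Ex (allVec k as) (λ v → X (a ∷ v)))
Ex-allVec k as X = Ex-product _∷_ as (allVec k as) X

Ex-allPairs : (as : List A) (bs : List B) (X : A × B → ℚ) →
  Ex (allPairs as bs) X ≡ Ex as (λ a → Ex bs (λ b → X (a , b)))
Ex-allPairs as bs X = Ex-product _,_ as bs X

-- Uniform hash functions and random signs

length-allFin : ∀ w → length (allFin w) ≡ w
length-allFin zero = refl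
length-allFin (suc w) = cong suc (trans (Listₚ.length-map suc (allFin w)) (length-allFin w))

sumOver-allFin : ∀ w (X : Fin w → ℚ) → sumOver (allFin w) X ≡ sumFin w X
sumOver-allFin zero X = refl
sumOver-allFin (suc w) X = cong (X zero +_) (trans (sumOver-map (allFin w) suc X) (sumOver-allFin w (X ∘ suc)))

Ex-allFin : ∀ w (X : Fin w → ℚ) → Ex (allFin w) X ≡ sumFin w X * inv w
Ex-allFin w X = trans (Ex≡ (allFin w) X)
  (cong₂ (λ x k → x * inv k) (sumOver-allFin w X) (length-allFin w))

-- The integrand takes the value at `zero` and the remaining function separately. On the functions
-- built by `allFun` both reduce by computation, so function extensionality is avoided.
Ex-allFun : (n : ℕ) (bs : List B) (Φ : B → (Fin n → B) → ℚ) →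
  Ex (allFun (suc n) bs) (λ h → Φ (h zero) (λ i → h (suc i))) ≡ Ex bs (λ b → Ex (allFun n bs) (Φ b))
Ex-allFun n bs Φ = Ex-product _ bs (allFun n bs) (λ h → Φ (h zero) (λ i → h (suc i)))

Ex-marginal : (n : ℕ) (bs : List B) (j : Fin n) {X : B → ℚ} → (∀ b → 0ℚ ≤ X b) →
  Ex (allFun n bs) (λ h → X (h j)) ≤ Ex bs X
Ex-marginal (suc n) bs zero {X} X≥0 = ≤-trans
  (≤-reflexive (Ex-allFun n bs (λ b _ → X b)))
  (Ex-mono bs (λ b → Ex-const≤ (allFun n bs) (X≥0 b)))
Ex-marginal (suc n) bs (suc j) {X} X≥0 = ≤-trans
  (≤-reflexive (Ex-allFun n bs (λ _ g → X (g j))))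
  (≤-trans (Ex-mono bs (λ _ → Ex-marginal n bs j X≥0)) (Ex-const≤ bs (Ex-nonneg bs X≥0)))

-- Peeling coordinates ends when one of the two indices is `zero`. With the value there fixed to
-- `b`, the other value is still uniform and equals `b` with probability 1/w.
collision : (n w : ℕ) (j i : Fin n) → j ≢ i →
  Ex (allFun n (allFin w)) (λ h → 𝟙 (does (h j Finₚ.≟ h i))) ≤ inv w
collision (suc n) w zero zero j≢i = ⊥-elim (j≢i refl)
collision (suc n) w zero (suc i) j≢i = ≤-trans
  (≤-reflexive (Ex-allFun n (allFin w) (λ b g → 𝟙 (does (b Finₚ.≟ g i)))))
  (Ex-≤const (allFin w) (0≤inv w) λ b → ≤-trans
    (Ex-marginal n (allFin w) i (λ c → 0≤𝟙 (does (b Finₚ.≟ c))))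
    (≤-trans (≤-reflexive (Ex-allFin w _))
      (≤-trans (*-monoʳ (0≤inv w) (sumFin-𝟙≟ʳ w b)) (≤-reflexive (*-identityˡ (inv w))))))
collision (suc n) w (suc j) zero j≢i = ≤-trans
  (≤-reflexive (Ex-allFun n (allFin w) (λ b g → 𝟙 (does (g j Finₚ.≟ b)))))
  (Ex-≤const (allFin w) (0≤inv w) λ b → ≤-trans
    (Ex-marginal n (allFin w) j (λ c → 0≤𝟙 (does (c Finₚ.≟ b))))
    (≤-trans (≤-reflexive (Ex-allFin w _))
      (≤-trans (*-monoʳ (0≤inv w) (sumFin-𝟙≟ˡ w b)) (≤-reflexive (*-identityˡ (inv w))))))
collision (suc n) w (suc j) (suc i) j≢i = ≤-trans
  (≤-reflexive (Ex-allFun n (allFin w) (λ _ g → 𝟙 (does (g j Finₚ.≟ g i)))))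
  (Ex-≤const (allFin w) (0≤inv w) λ _ → collision n w j i (λ j≡i → j≢i (cong suc j≡i)))

bools : List Bool
bools = true ∷ false ∷ []

-- The offset `a` is there for the induction: it absorbs the first signed term, and averaging the
-- squares of a + c and a - c cancels the cross term.
sign-second-moment : (n : ℕ) (a : ℚ) (c : Fin n → ℚ) →
  Ex (allFun n bools) (λ s → (a + sumFin n (λ j → c j * sgn (s j))) * (a + sumFin n (λ j → c j * sgn (s j))))
    ≤ a * a + sumFin n (λ j → c j * c j)
sign-second-moment zero a c = ≤-reflexive (lem a)
  where
  lem : ∀ a → ((a + 0ℚ) * (a + 0ℚ) + 0ℚ) * 1ℚ ≡ a * a + 0ℚ
  lem = solve-∀ ℚ-ring
sign-second-moment (suc n) a c = begin
  Ex (allFun (suc n) bools) (λ s → Φ (s zero) (λ j → s (suc j)))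
    ≡⟨ Ex-allFun n bools Φ ⟩
  (E 1ℚ + (E (0ℚ - 1ℚ) + 0ℚ)) * (ℤ.+ 1 / 2)
    ≤⟨ *-monoʳ (nonNegative⁻¹ (ℤ.+ 1 / 2)) (+-mono-≤ (bound 1ℚ) (+-mono-≤ (bound (0ℚ - 1ℚ)) ≤-refl)) ⟩
  (((a + c zero * 1ℚ) * (a + c zero * 1ℚ) + S) +
    (((a + c zero * (0ℚ - 1ℚ)) * (a + c zero * (0ℚ - 1ℚ)) + S) + 0ℚ)) * (ℤ.+ 1 / 2)
    ≡⟨ lem a (c zero) S ⟩
  a * a + (c zero * c zero + S) ∎
  where
  open ≤-Reasoning
  S = sumFin n (λ j → c (suc j) * c (suc j))
  R : (Fin n → Bool) → ℚ
  R s = sumFin n (λ j → c (suc j) * sgn (s j))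
  Φ : Bool → (Fin n → Bool) → ℚ
  Φ b s = (a + (c zero * sgn b + R s)) * (a + (c zero * sgn b + R s))
  E : ℚ → ℚ
  E x = Ex (allFun n bools) (λ s → (a + (c zero * x + R s)) * (a + (c zero * x + R s)))
  bound : ∀ x → E x ≤ (a + c zero * x) * (a + c zero * x) + S
  bound x = ≤-trans
    (≤-reflexive (Ex-cong (allFun n bools) (λ s → cong (λ y → y * y) (sym (+-assoc a (c zero * x) (R s))))))
    (sign-second-moment n (a + c zero * x) (c ∘ suc))
  lem : ∀ a c s → (((a + c * 1ℚ) * (a + c * 1ℚ) + s) +
    (((a + c * (0ℚ - 1ℚ)) * (a + c * (0ℚ - 1ℚ)) + s) + 0ℚ)) * (ℤ.+ 1 / 2) ≡ a * a + (c * c + s)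
  lem = solve-∀ ℚ-ring

-- Medians and counting

module _ {P : Pred ℚ 0ℓ} (P? : Decidable P) where

  count : List ℚ → ℕ
  count xs = length (filter P? xs)

  count-↭ : ∀ {xs ys} → xs ↭ ys → count xs ≡ count ys
  count-↭ = ↭-length ∘ filter-↭ P?

  count-∷ : ∀ x xs → count xs ℕ.≤ count (x ∷ xs)
  count-∷ x xs with P? x
  ... | yes _ = ℕₚ.n≤1+n _
  ... | no _ = ℕₚ.≤-refl

All-nth : ∀ {P : Pred ℚ 0ℓ} {xs} → All P xs → ∀ k → k ℕ.< length xs → P (headOr0 (drop k xs))
All-nth (px ∷ pxs) zero k< = px
All-nth (px ∷ pxs) (suc k) (s≤s k<) = All-nth pxs k k<

count-≤nth : ∀ {xs} → AllPairs _≤_ xs → ∀ k → k ℕ.< length xs →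
  suc k ℕ.≤ count (_≤? headOr0 (drop k xs)) xs
count-≤nth {x ∷ xs} (x≤ ∷ xs↗) zero k< =
  ℕₚ.≤-trans (s≤s z≤n) (ℕₚ.≤-reflexive (sym (cong length (Listₚ.filter-accept (_≤? x) {xs = xs} ≤-refl))))
count-≤nth {x ∷ xs} (x≤ ∷ xs↗) (suc k) (s≤s k<) =
  ℕₚ.≤-trans (s≤s (count-≤nth xs↗ k k<))
    (ℕₚ.≤-reflexive (sym (cong length (Listₚ.filter-accept (_≤? _) {xs = xs} (All-nth x≤ k k<)))))

-- Everything from position `k` on is at least the entry there. Past the end the default value of
-- `headOr0` is harmless, since the truncated difference is 0.
count-nth≤ : ∀ {xs} → AllPairs _≤_ xs → ∀ k → length xs ℕ.∸ k ℕ.≤ count (headOr0 (drop k xs) ≤?_) xs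
count-nth≤ {[]} _ k = ℕₚ.≤-reflexive (ℕₚ.0∸n≡0 k)
count-nth≤ {x ∷ xs} (x≤ ∷ xs↗) zero =
  ℕₚ.≤-reflexive (sym (cong length (Listₚ.filter-all (x ≤?_) (≤-refl ∷ x≤))))
count-nth≤ {x ∷ xs} (x≤ ∷ xs↗) (suc k) = ℕₚ.≤-trans (count-nth≤ xs↗ k) (count-∷ _ x xs)

midIndex : ℕ → ℕ
midIndex m = (m ℕ.∸ 1) ℕ./ 2

sorted-pairs : ∀ xs → AllPairs _≤_ (sort xs)
sorted-pairs xs = Linkedₚ.Linked⇒AllPairs ≤-trans (sort-↗ xs)

count-≤median : ∀ x xs → suc (midIndex (length (x ∷ xs))) ℕ.≤ count (_≤? median (x ∷ xs)) (x ∷ xs)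
count-≤median x xs = ℕₚ.≤-trans
  (count-≤nth (sorted-pairs (x ∷ xs)) (midIndex (suc (length xs)))
    (ℕₚ.<-≤-trans (s≤s (DivMod.m/n≤m (length xs) 2)) (ℕₚ.≤-reflexive (sym (↭-length (sort-↭ (x ∷ xs)))))))
  (ℕₚ.≤-reflexive (count-↭ (_≤? median (x ∷ xs)) (sort-↭ (x ∷ xs))))

count-median≤ : ∀ xs → length xs ℕ.∸ midIndex (length xs) ℕ.≤ count (median xs ≤?_) xs
count-median≤ xs = ℕₚ.≤-trans
  (ℕₚ.≤-reflexive (cong (ℕ._∸ midIndex (length xs)) (sym (↭-length (sort-↭ xs)))))
  (ℕₚ.≤-trans (count-nth≤ (sorted-pairs xs) (midIndex (length xs)))
    (ℕₚ.≤-reflexive (count-↭ (median xs ≤?_) (sort-↭ xs))))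

length-values : ∀ {k} (X : A → ℚ) (v : Vec A k) → length (toList (Vec.map X v)) ≡ k
length-values X v = Vecₚ.length-toList (Vec.map X v)

-- Sums over pairs and products over all entries of a random vector

starSum : (A → A → ℚ) → A → ∀ {k} → Vec A k → ℚ
starSum op a [] = 0ℚ
starSum op a (b ∷ v) = op a b + starSum op a v

-- The sum of `op` over all pairs of positions a < b. It serves as a union bound: if two entries are
-- bad, some summand is large.
pairSum : (A → A → ℚ) → ∀ {k} → Vec A k → ℚ
pairSum op [] = 0ℚ
pairSum op (a ∷ v) = starSum op a v + pairSum op v

module _ (op : A → A → ℚ) (op≥0 : ∀ a b → 0ℚ ≤ op a b) where

  starSum-nonneg : ∀ a {k} (v : Vec A k) → 0ℚ ≤ starSum op a v
  starSum-nonneg a [] = ≤-refl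
  starSum-nonneg a (b ∷ v) = +-nonneg (op≥0 a b) (starSum-nonneg a v)

  pairSum-nonneg : ∀ {k} (v : Vec A k) → 0ℚ ≤ pairSum op v
  pairSum-nonneg [] = ≤-refl
  pairSum-nonneg (a ∷ v) = +-nonneg (starSum-nonneg a v) (pairSum-nonneg v)

  module _ {P : Pred ℚ 0ℓ} (P? : Decidable P) (X : A → ℚ) (t : ℚ)
           (hit : ∀ a b → P (X a) → P (X b) → t ≤ op a b) where

    starSum-hit : ∀ a → P (X a) → ∀ {k} (v : Vec A k) →
      1 ℕ.≤ count P? (toList (Vec.map X v)) → t ≤ starSum op a v
    starSum-hit a pa (b ∷ v) c≥1 with P? (X b)
    ... | yes pb = ≤-trans (hit a b pa pb) (p≤p+q (starSum-nonneg a v))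
    ... | no _ = ≤-trans (starSum-hit a pa v c≥1) (p≤q+p (op≥0 a b))

    pairSum-hit : ∀ {k} (v : Vec A k) → 2 ℕ.≤ count P? (toList (Vec.map X v)) → t ≤ pairSum op v
    pairSum-hit (a ∷ v) c≥2 with P? (X a)
    ... | yes pa = ≤-trans (starSum-hit a pa v (ℕₚ.≤-pred c≥2)) (p≤p+q (pairSum-nonneg v))
    ... | no _ = ≤-trans (pairSum-hit v c≥2) (p≤q+p (starSum-nonneg a v))

  Ex-starSum : (as : List A) (k : ℕ) (a : A) → Ex (allVec k as) (starSum op a) ≤ ℕtoℚ k * Ex as (op a)
  Ex-starSum as zero a = ≤-reflexive (sym (*-zeroˡ (Ex as (op a))))
  Ex-starSum as (suc k) a = begin
    Ex (allVec (suc k) as) (starSum op a)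
      ≡⟨ Ex-allVec k as (starSum op a) ⟩
    Ex as (λ b → Ex (allVec k as) (λ v → op a b + starSum op a v))
      ≤⟨ Ex-mono as (λ b → ≤-trans (≤-reflexive (Ex-+ (allVec k as) (λ _ → op a b) (starSum op a)))
           (+-mono-≤ (Ex-const≤ (allVec k as) (op≥0 a b)) (Ex-starSum as k a))) ⟩
    Ex as (λ b → op a b + ℕtoℚ k * e)
      ≡⟨ Ex-+ as (op a) (λ _ → ℕtoℚ k * e) ⟩
    e + Ex as (λ _ → ℕtoℚ k * e)
      ≤⟨ +-monoʳ-≤ e (Ex-const≤ as (*-nonneg (0≤ℕtoℚ k) (Ex-nonneg as (op≥0 a)))) ⟩
    e + ℕtoℚ k * e
      ≡⟨ lem e (ℕtoℚ k) ⟩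
    (1ℚ + ℕtoℚ k) * e
      ≡⟨ cong (_* e) (sym (ℕtoℚ-suc k)) ⟩
    ℕtoℚ (suc k) * e ∎
    where
    open ≤-Reasoning
    e = Ex as (op a)
    lem : ∀ e k → e + k * e ≡ (1ℚ + k) * e
    lem = solve-∀ ℚ-ring

  -- The two entries of a pair are independent, so each pair contributes at most `μ`. The crude
  -- count k² in place of k(k-1)/2 avoids a division and still closes the induction, as k² + k ≤
  -- (k+1)².
  Ex-pairSum : (as : List A) (k : ℕ) {μ : ℚ} → Ex as (λ a → Ex as (op a)) ≤ μ →
    Ex (allVec k as) (pairSum op) ≤ ℕtoℚ k * ℕtoℚ k * μ
  Ex-pairSum as zero {μ} _ = ≤-reflexive (sym (*-zeroˡ μ))
  Ex-pairSum as (suc k) {μ} E≤μ = begin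
    Ex (allVec (suc k) as) (pairSum op)
      ≡⟨ Ex-allVec k as (pairSum op) ⟩
    Ex as (λ a → Ex (allVec k as) (λ v → starSum op a v + pairSum op v))
      ≤⟨ Ex-mono as (λ a → ≤-trans (≤-reflexive (Ex-+ (allVec k as) (starSum op a) (pairSum op)))
           (+-mono-≤ (Ex-starSum as k a) (Ex-pairSum as k E≤μ))) ⟩
    Ex as (λ a → κ * Ex as (op a) + κ * κ * μ)
      ≡⟨ Ex-+ as (λ a → κ * Ex as (op a)) (λ _ → κ * κ * μ) ⟩
    Ex as (λ a → κ * Ex as (op a)) + Ex as (λ _ → κ * κ * μ)
      ≤⟨ +-mono-≤ (≤-trans (≤-reflexive (Ex-*ˡ as κ (λ a → Ex as (op a)))) (*-monoˡ κ≥0 E≤μ))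
                  (Ex-const≤ as (*-nonneg (*-nonneg κ≥0 κ≥0) μ≥0)) ⟩
    κ * μ + κ * κ * μ
      ≤⟨ ≤-by (+-nonneg (*-nonneg κ≥0 μ≥0) μ≥0) (lem κ μ) ⟩
    (1ℚ + κ) * (1ℚ + κ) * μ
      ≡⟨ cong (λ x → x * x * μ) (sym (ℕtoℚ-suc k)) ⟩
    ℕtoℚ (suc k) * ℕtoℚ (suc k) * μ ∎
    where
    open ≤-Reasoning
    κ = ℕtoℚ k
    κ≥0 : 0ℚ ≤ κ
    κ≥0 = 0≤ℕtoℚ k
    μ≥0 : 0ℚ ≤ μ
    μ≥0 = ≤-trans (Ex-nonneg as (λ a → Ex-nonneg as (op≥0 a))) E≤μ
    lem : ∀ k m → (1ℚ + k) * (1ℚ + k) * m ≡ (k * m + k * k * m) + (k * m + m)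
    lem = solve-∀ ℚ-ring

productOver : (A → ℚ) → ∀ {k} → Vec A k → ℚ
productOver g [] = 1ℚ
productOver g (a ∷ v) = g a * productOver g v

0≤¼ : 0ℚ ≤ inv 4
0≤¼ = 0≤inv 4

module _ (g : A → ℚ) (g≥¼ : ∀ a → inv 4 ≤ g a) where

  productOver-nonneg : ∀ {k} (v : Vec A k) → 0ℚ ≤ productOver g v
  productOver-nonneg [] = 0≤1
  productOver-nonneg (a ∷ v) = *-nonneg (≤-trans 0≤¼ (g≥¼ a)) (productOver-nonneg v)

  module _ {P : Pred ℚ 0ℓ} (P? : Decidable P) (X : A → ℚ) (hit : ∀ a → P (X a) → ℕtoℚ 4 ≤ g a) where

    -- With c hits the product is at least 4^c (1/4)^(k-c). Writing this as 16^c / 4^k avoids the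
    -- subtraction, and it is at least 1 as soon as k ≤ 2c.
    productOver-count : ∀ {k} (v : Vec A k) →
      ℕtoℚ (16 ℕ.^ count P? (toList (Vec.map X v))) * inv (4 ℕ.^ k) ≤ productOver g v
    productOver-count [] = ≤-refl
    productOver-count {suc k} (a ∷ v) with P? (X a)
    ... | yes pa = ≤-trans
          (≤-reflexive (trans (cong₂ _*_ (ℕtoℚ-* 16 (16 ℕ.^ c)) (inv-* 4 (4 ℕ.^ k)))
            (lem (ℕtoℚ (16 ℕ.^ c)) (inv (4 ℕ.^ k)))))
          (*-mono (0≤ℕtoℚ 4) (productOver-nonneg v) (hit a pa) (productOver-count v))
      where
      c = count P? (toList (Vec.map X v))
      lem : ∀ x y → (ℤ.+ 16 / 1) * x * ((ℤ.+ 1 / 4) * y) ≡ (ℤ.+ 4 / 1) * (x * y)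
      lem = solve-∀ ℚ-ring
    ... | no _ = ≤-trans
          (≤-reflexive (trans (cong (ℕtoℚ (16 ℕ.^ c) *_) (inv-* 4 (4 ℕ.^ k)))
            (lem (ℕtoℚ (16 ℕ.^ c)) (inv (4 ℕ.^ k)))))
          (*-mono 0≤¼ (productOver-nonneg v) (g≥¼ a) (productOver-count v))
      where
      c = count P? (toList (Vec.map X v))
      lem : ∀ x y → x * ((ℤ.+ 1 / 4) * y) ≡ (ℤ.+ 1 / 4) * (x * y)
      lem = solve-∀ ℚ-ring

    productOver-hit : ∀ {k} (v : Vec A k) → k ℕ.≤ 2 ℕ.* count P? (toList (Vec.map X v)) → 1ℚ ≤ productOver g v
    productOver-hit {k} v k≤2c = begin
      1ℚ                                    ≡⟨ sym (ℕtoℚ*inv (4 ℕ.^ k) {{ℕₚ.m^n≢0 4 k}}) ⟩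
      ℕtoℚ (4 ℕ.^ k) * inv (4 ℕ.^ k)        ≤⟨ *-monoʳ (0≤inv (4 ℕ.^ k)) (ℕtoℚ-mono (ℕₚ.^-monoʳ-≤ 4 k≤2c)) ⟩
      ℕtoℚ (4 ℕ.^ (2 ℕ.* c)) * inv (4 ℕ.^ k) ≡⟨ cong (λ x → ℕtoℚ x * inv (4 ℕ.^ k)) (sym (ℕₚ.^-*-assoc 4 2 c)) ⟩
      ℕtoℚ (16 ℕ.^ c) * inv (4 ℕ.^ k)       ≤⟨ productOver-count v ⟩
      productOver g v ∎
      where
      open ≤-Reasoning
      c = count P? (toList (Vec.map X v))

  -- Independence factors the expectation. Together with `productOver-hit` this is an exponentially
  -- small bound on the event that half of the entries are hits, obtained from first moments alone.
  Ex-productOver : (as : List A) (k : ℕ) → Ex as g ≤ inv 2 → Ex (allVec k as) (productOver g) ≤ inv (2 ℕ.^ k)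
  Ex-productOver as zero _ = ≤-refl
  Ex-productOver as (suc k) E≤½ = begin
    Ex (allVec (suc k) as) (productOver g)
      ≡⟨ Ex-allVec k as (productOver g) ⟩
    Ex as (λ a → Ex (allVec k as) (λ v → g a * productOver g v))
      ≤⟨ Ex-mono as (λ a → ≤-trans (≤-reflexive (Ex-*ˡ (allVec k as) (g a) (productOver g)))
           (*-monoˡ (≤-trans 0≤¼ (g≥¼ a)) (Ex-productOver as k E≤½))) ⟩
    Ex as (λ a → g a * inv (2 ℕ.^ k))
      ≡⟨ Ex-*ʳ as (inv (2 ℕ.^ k)) g ⟩
    Ex as g * inv (2 ℕ.^ k)
      ≤⟨ *-monoʳ (0≤inv (2 ℕ.^ k)) E≤½ ⟩
    inv 2 * inv (2 ℕ.^ k)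
      ≡⟨ sym (inv-* 2 (2 ℕ.^ k)) ⟩
    inv (2 ℕ.^ suc k) ∎
    where open ≤-Reasoning

-- How far a median can deviate

p-q≤∣p-q∣ : ∀ {x m} f → m ≤ x → m - f ≤ ∣ x - f ∣
p-q≤∣p-q∣ {x} f m≤x = ≤-trans (+-monoˡ-≤ (- f) m≤x) (p≤∣p∣ (x - f))

q-p≤∣p-q∣ : ∀ {x m} f → x ≤ m → f - m ≤ ∣ x - f ∣
q-p≤∣p-q∣ {x} {m} f x≤m = ≤-trans (+-monoʳ-≤ f (neg-antimono-≤ x≤m))
  (≤-trans (≤-reflexive (lem f x)) (≤-trans (p≤∣p∣ (- (x - f))) (≤-reflexive (∣-p∣≡∣p∣ (x - f)))))
  where
  lem : ∀ f x → f - x ≡ - (x - f)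
  lem = solve-∀ ℚ-ring

-- If the median lies above `f`, two of the three entries are at least the median and so err at
-- least as much; below `f` it is symmetric. Both counts compute to 2 for length 3.
median₃-error : (X : A → ℚ) (f : ℚ) (v : Vec A 3) →
  ∣ median (toList (Vec.map X v)) - f ∣ ≤ pairSum (λ a b → ∣ X a - f ∣ ⊓ ∣ X b - f ∣) v
median₃-error X f v@(a ∷ b ∷ c ∷ []) with ≤-total 0ℚ (median (toList (Vec.map X v)) - f)
... | inj₁ 0≤m-f = pairSum-hit _ (λ a b → ⊓-nonneg (0≤∣p∣ (X a - f)) (0≤∣p∣ (X b - f))) (m ≤?_) X _
        (λ a b ma mb → ≤-trans (≤-reflexive (0≤p⇒∣p∣≡p 0≤m-f)) (⊓-glb (p-q≤∣p-q∣ f ma) (p-q≤∣p-q∣ f mb)))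
        v (count-median≤ (toList (Vec.map X v)))
  where m = median (toList (Vec.map X v))
... | inj₂ m-f≤0 = pairSum-hit _ (λ a b → ⊓-nonneg (0≤∣p∣ (X a - f)) (0≤∣p∣ (X b - f))) (_≤? m) X _
        (λ a b ma mb → ≤-trans (≤-reflexive eq) (⊓-glb (q-p≤∣p-q∣ f ma) (q-p≤∣p-q∣ f mb)))
        v (count-≤median (X a) (X b ∷ X c ∷ []))
  where
  m = median (toList (Vec.map X v))
  lem : ∀ f x → - (x - f) ≡ f - x
  lem = solve-∀ ℚ-ring
  eq : ∣ m - f ∣ ≡ f - m
  eq = trans (sym (∣-p∣≡∣p∣ (m - f))) (trans (0≤p⇒∣p∣≡p (neg-antimono-≤ m-f≤0)) (lem f m))

-- From `k` = 3 on the lower median has rank at least 1 counted from 0, so at least two entries are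
-- at most the median, hence below `τ`. Each of them forces f ≤ τ + error.
median<τ : ∀ {k} (X : A → ℚ) (f τ : ℚ) → 0ℚ ≤ f → 0ℚ ≤ τ → 3 ℕ.≤ k → (v : Vec A k) →
  median (toList (Vec.map X v)) < τ →
  f * f ≤ pairSum (λ a b → (τ + ∣ X a - f ∣) * (τ + ∣ X b - f ∣)) v
median<τ X f τ f≥0 τ≥0 (s≤s 2≤k) v@(a ∷ w) m<τ =
  pairSum-hit _ (λ a b → *-nonneg (u≥0 a) (u≥0 b)) (_≤? m) X (f * f)
    (λ a b ma mb → *-mono f≥0 (u≥0 b) (f≤u a ma) (f≤u b mb)) v
    (ℕₚ.≤-trans (s≤s (DivMod./-monoˡ-≤ 2 (ℕₚ.≤-trans 2≤k (ℕₚ.≤-reflexive (sym (length-values X w))))))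
      (count-≤median (X a) (toList (Vec.map X w))))
  where
  m = median (toList (Vec.map X v))
  u≥0 : ∀ a → 0ℚ ≤ τ + ∣ X a - f ∣
  u≥0 a = +-nonneg τ≥0 (0≤∣p∣ (X a - f))
  lem : ∀ f x → f ≡ x + (f - x)
  lem = solve-∀ ℚ-ring
  f≤u : ∀ a → X a ≤ m → f ≤ τ + ∣ X a - f ∣
  f≤u a Xa≤m = ≤-trans (≤-reflexive (lem f m)) (+-mono-≤ (<⇒≤ m<τ) (q-p≤∣p-q∣ f Xa≤m))

-- At least half of the entries are at least the median, since 2 `midIndex` k ≤ k, and each of these
-- errs by at least τ - f. The constant 15/4 = 4 - 1/4 lifts their factors from the floor 1/4 to the
-- 4 that balances one factor 1/4.
median≥τ : ∀ {k} (X : A → ℚ) (f τ κ : ℚ) → 0ℚ ≤ κ → ℤ.+ 15 / 4 ≤ κ * (τ - f) → (v : Vec A k) →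
  τ ≤ median (toList (Vec.map X v)) → 1ℚ ≤ productOver (λ a → inv 4 + κ * ∣ X a - f ∣) v
median≥τ {k = k} X f τ κ κ≥0 gap v τ≤m =
  productOver-hit _ (λ a → p≤p+q (*-nonneg κ≥0 (0≤∣p∣ _))) (m ≤?_) X
    (λ a m≤Xa → +-monoʳ-≤ (inv 4) (≤-trans gap (*-monoˡ κ≥0 (p-q≤∣p-q∣ f (≤-trans τ≤m m≤Xa))))) v
    (ℕₚ.≤-trans half (ℕₚ.*-monoʳ-≤ 2 (count-median≤ (toList (Vec.map X v)))))
  where
  m = median (toList (Vec.map X v))
  len = length (toList (Vec.map X v))
  half : k ℕ.≤ 2 ℕ.* (len ℕ.∸ midIndex len)
  half rewrite length-values X v = begin
    k                               ≡⟨ sym (ℕₚ.m+n∸n≡m k k) ⟩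
    k ℕ.+ k ℕ.∸ k                   ≤⟨ ℕₚ.∸-monoʳ-≤ (k ℕ.+ k) (ℕₚ.≤-trans (DivMod.m/n*n≤m (k ℕ.∸ 1) 2) (ℕₚ.m∸n≤m k 1)) ⟩
    k ℕ.+ k ℕ.∸ midIndex k ℕ.* 2    ≡⟨ cong₂ ℕ._∸_ (cong (k ℕ.+_) (sym (ℕₚ.+-identityʳ k))) (ℕₚ.*-comm (midIndex k) 2) ⟩
    2 ℕ.* k ℕ.∸ 2 ℕ.* midIndex k    ≡⟨ sym (ℕₚ.*-distribˡ-∸ 2 k (midIndex k)) ⟩
    2 ℕ.* (k ℕ.∸ midIndex k) ∎
    where open ℕₚ.≤-Reasoning

-- The error of one row

⊓-subadditiveˡ : ∀ {x y z} → 0ℚ ≤ x → 0ℚ ≤ y → 0ℚ ≤ z → (x + y) ⊓ z ≤ (x ⊓ z) + (y ⊓ z)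
⊓-subadditiveˡ {x} {y} {z} x≥0 y≥0 z≥0 with ≤-total x z | ≤-total y z
... | inj₂ z≤x | _ = ≤-trans (p⊓q≤q (x + y) z)
        (≤-trans (≤-reflexive (sym (p≥q⇒p⊓q≡q z≤x))) (p≤p+q (⊓-nonneg y≥0 z≥0)))
... | inj₁ _ | inj₂ z≤y = ≤-trans (p⊓q≤q (x + y) z)
        (≤-trans (≤-reflexive (sym (p≥q⇒p⊓q≡q z≤y))) (p≤q+p (⊓-nonneg x≥0 z≥0)))
... | inj₁ x≤z | inj₁ y≤z = ≤-trans (p⊓q≤p (x + y) z)
        (≤-reflexive (cong₂ _+_ (sym (p≤q⇒p⊓q≡p x≤z)) (sym (p≤q⇒p⊓q≡p y≤z))))

sumFin-⊓ˡ : ∀ n (a : Fin n → ℚ) → (∀ j → 0ℚ ≤ a j) → ∀ {z} → 0ℚ ≤ z →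
  sumFin n a ⊓ z ≤ sumFin n (λ j → a j ⊓ z)
sumFin-⊓ˡ zero a a≥0 {z} z≥0 = p⊓q≤p 0ℚ z
sumFin-⊓ˡ (suc n) a a≥0 z≥0 = ≤-trans
  (⊓-subadditiveˡ (a≥0 zero) (sumFin-nonneg n (a≥0 ∘ suc)) z≥0)
  (+-monoʳ-≤ (a zero ⊓ _) (sumFin-⊓ˡ n (a ∘ suc) (a≥0 ∘ suc) z≥0))

sumFin-⊓ : ∀ m n (a : Fin m → ℚ) (b : Fin n → ℚ) → (∀ j → 0ℚ ≤ a j) → (∀ l → 0ℚ ≤ b l) →
  sumFin m a ⊓ sumFin n b ≤ sumFin m (λ j → sumFin n (λ l → a j ⊓ b l))
sumFin-⊓ m n a b a≥0 b≥0 = ≤-trans (sumFin-⊓ˡ m a a≥0 (sumFin-nonneg n b≥0))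
  (sumFin-mono m λ j → ≤-trans (≤-reflexive (⊓-comm (a j) (sumFin n b)))
    (≤-trans (sumFin-⊓ˡ n b b≥0 (a≥0 j)) (≤-reflexive (sumFin-cong n (λ l → ⊓-comm (b l) (a j))))))

-- The minimum becomes a product of the two collision indicators. Since they belong to independent
-- rows, each will contribute its own factor 1/w.
𝟙-⊓ : ∀ b b′ {x y} → 0ℚ ≤ x → 0ℚ ≤ y → (𝟙 b * x) ⊓ (𝟙 b′ * y) ≤ 𝟙 b * (𝟙 b′ * (x ⊓ y))
𝟙-⊓ true true {x} {y} _ _ = ≤-reflexive (trans (cong₂ _⊓_ (*-identityˡ x) (*-identityˡ y))
  (sym (trans (*-identityˡ (1ℚ * (x ⊓ y))) (*-identityˡ (x ⊓ y)))))
𝟙-⊓ true false {x} {y} _ _ = ≤-trans (p⊓q≤q (1ℚ * x) (0ℚ * y)) (≤-reflexive (lem y (x ⊓ y)))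
  where
  lem : ∀ y m → 0ℚ * y ≡ 1ℚ * (0ℚ * m)
  lem = solve-∀ ℚ-ring
𝟙-⊓ false b′ {x} {y} _ _ = ≤-trans (p⊓q≤p (0ℚ * x) (𝟙 b′ * y)) (≤-reflexive (lem x (𝟙 b′ * (x ⊓ y))))
  where
  lem : ∀ x m → 0ℚ * x ≡ 0ℚ * m
  lem = solve-∀ ℚ-ring

-- Tail noise may leave the minimum, because its expectation is already O(1/w) in a single row; only
-- the head needs the gain from two rows.
⊓-perturb : ∀ a b {y z} → 0ℚ ≤ y → 0ℚ ≤ z → (a + y) ⊓ (b + z) ≤ (a ⊓ b) + (y + z)
⊓-perturb a b {y} {z} y≥0 z≥0 with ≤-total a b
... | inj₁ a≤b = ≤-trans (p⊓q≤p (a + y) (b + z))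
        (+-mono-≤ (≤-reflexive (sym (p≤q⇒p⊓q≡p a≤b))) (p≤p+q z≥0))
... | inj₂ b≤a = ≤-trans (p⊓q≤q (a + y) (b + z))
        (+-mono-≤ (≤-reflexive (sym (p≥q⇒p⊓q≡q b≤a))) (p≤q+p y≥0))

∣sgn∣ : ∀ b → ∣ sgn b ∣ ≡ 1ℚ
∣sgn∣ true = refl
∣sgn∣ false = refl

sgn² : ∀ b → sgn b * sgn b ≡ 1ℚ
sgn² true = refl
sgn² false = refl

-- Head and tail noise of a row

allRows : (n w : ℕ) → List (Row n w)
allRows n w = allPairs (allFun n (allFin w)) (allFun n bools)

-- Item `i` itself is zeroed, so that no sum has to skip an index. Indices start at 0, hence
-- `toℕ j ℕ.<ᵇ w` means rank at most w. Cutting at the width of the table balances the two noises.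
headPart tailPart : {n : ℕ} (w : ℕ) (f : Fin n → ℚ) (i j : Fin n) → ℚ
headPart w f i j = if does (j Finₚ.≟ i) then 0ℚ else if toℕ j ℕ.<ᵇ w then f j else 0ℚ
tailPart w f i j = if does (j Finₚ.≟ i) then 0ℚ else if toℕ j ℕ.<ᵇ w then 0ℚ else f j

rowErr : {n w : ℕ} → (Fin n → ℚ) → Fin n → Row n w → ℚ
rowErr f i r = ∣ rowEst f r i - f i ∣

tableErr : {n w : ℕ} → (Fin n → ℚ) → Fin n → Table n w → ℚ
tableErr f i S = ∣ csEst f S i - f i ∣

module _ {n w : ℕ} .{{_ : NonZero w}} (f : Fin n → ℚ) (f≥0 : ∀ j → 0ℚ ≤ f j) (i : Fin n) where

  private
    hd tl : Fin n → ℚ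
    hd = headPart w f i
    tl = tailPart w f i

    hit : (Fin n → Fin w) → Fin n → Bool
    hit h j = does (h j Finₚ.≟ h i)

    EH : ((Fin n → Fin w) → ℚ) → ℚ
    EH = Ex (allFun n (allFin w))

  headPart-nonneg : ∀ j → 0ℚ ≤ hd j
  headPart-nonneg j with does (j Finₚ.≟ i)
  ... | true = ≤-refl
  ... | false with toℕ j ℕ.<ᵇ w
  ... | true = f≥0 j
  ... | false = ≤-refl

  headPart-self : ∀ j → j ≡ i → hd j ≡ 0ℚ
  headPart-self j j≡i rewrite dec-true (j Finₚ.≟ i) j≡i = refl

  tailPart-self : ∀ j → j ≡ i → tl j ≡ 0ℚ
  tailPart-self j j≡i rewrite dec-true (j Finₚ.≟ i) j≡i = refl

  headNoise tailNoise : Row n w → ℚ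
  headNoise (h , s) = sumFin n (λ j → 𝟙 (hit h j) * hd j)
  tailNoise (h , s) = sumFin n (λ j → 𝟙 (hit h j) * tl j * sgn (s j))

  -- The own contribution cancels `f i` because the sign of `i` squares to 1. The triangle
  -- inequality discards the signs of the head, whereas the tail keeps them for its second moment.
  rowErr≤noise : ∀ r → rowErr f i r ≤ headNoise r + ∣ tailNoise r ∣
  rowErr≤noise r@(h , s) = begin
    ∣ sgn (s i) * sumFin n F - f i ∣
      ≡⟨ cong (λ x → ∣ sgn (s i) * x - f i ∣) (trans (sumFin-extract n i F) (cong₂ _+_ Fi (sumFin-cong n split))) ⟩
    ∣ sgn (s i) * (sgn (s i) * f i + sumFin n (λ j → G j + H j)) - f i ∣
      ≡⟨ cong ∣_∣ (trans (lem (sgn (s i)) (f i) _)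
           (trans (cong (λ x → x * f i + sgn (s i) * sumFin n (λ j → G j + H j) - f i) (sgn² (s i))) (lem′ (f i) _))) ⟩
    ∣ sgn (s i) * sumFin n (λ j → G j + H j) ∣
      ≡⟨ trans (∣p*q∣≡∣p∣*∣q∣ (sgn (s i)) _) (trans (cong (_* ∣ sumFin n (λ j → G j + H j) ∣) (∣sgn∣ (s i))) (*-identityˡ _)) ⟩
    ∣ sumFin n (λ j → G j + H j) ∣
      ≡⟨ cong ∣_∣ (sumFin-+ n G H) ⟩
    ∣ sumFin n G + sumFin n H ∣
      ≤⟨ ∣p+q∣≤∣p∣+∣q∣ (sumFin n G) (sumFin n H) ⟩
    ∣ sumFin n G ∣ + ∣ sumFin n H ∣
      ≤⟨ +-monoˡ-≤ ∣ sumFin n H ∣ (≤-trans (∣sumFin∣≤ n G) (≤-reflexive (sumFin-cong n ∣G∣))) ⟩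
    headNoise r + ∣ tailNoise r ∣ ∎
    where
    open ≤-Reasoning
    F G H : Fin n → ℚ
    F j = if hit h j then sgn (s j) * f j else 0ℚ
    G j = 𝟙 (hit h j) * hd j * sgn (s j)
    H j = 𝟙 (hit h j) * tl j * sgn (s j)
    Fi : F i ≡ sgn (s i) * f i
    Fi rewrite dec-true (h i Finₚ.≟ h i) refl = refl
    lem : ∀ x y z → x * (x * y + z) - y ≡ x * x * y + x * z - y
    lem = solve-∀ ℚ-ring
    lem′ : ∀ y z → 1ℚ * y + z - y ≡ z
    lem′ = solve-∀ ℚ-ring
    split′ : ∀ b₁ b₂ b₃ x y →
      (if b₁ then 0ℚ else if b₃ then x * y else 0ℚ) ≡
      𝟙 b₃ * (if b₁ then 0ℚ else if b₂ then y else 0ℚ) * x +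
      𝟙 b₃ * (if b₁ then 0ℚ else if b₂ then 0ℚ else y) * x
    split′ true b₂ b₃ x y = l (𝟙 b₃) x
      where
      l : ∀ k x → 0ℚ ≡ k * 0ℚ * x + k * 0ℚ * x
      l = solve-∀ ℚ-ring
    split′ false true true x y = l x y
      where
      l : ∀ x y → x * y ≡ 1ℚ * y * x + 1ℚ * 0ℚ * x
      l = solve-∀ ℚ-ring
    split′ false false true x y = l x y
      where
      l : ∀ x y → x * y ≡ 1ℚ * 0ℚ * x + 1ℚ * y * x
      l = solve-∀ ℚ-ring
    split′ false b₂ false x y = l x (if b₂ then y else 0ℚ) (if b₂ then 0ℚ else y)
      where
      l : ∀ x y z → 0ℚ ≡ 0ℚ * y * x + 0ℚ * z * x
      l = solve-∀ ℚ-ring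
    split : ∀ j → (if does (j Finₚ.≟ i) then 0ℚ else F j) ≡ G j + H j
    split j = split′ (does (j Finₚ.≟ i)) (toℕ j ℕ.<ᵇ w) (hit h j) (sgn (s j)) (f j)
    ∣G∣ : ∀ j → ∣ G j ∣ ≡ 𝟙 (hit h j) * hd j
    ∣G∣ j = trans (∣p*q∣≡∣p∣*∣q∣ (𝟙 (hit h j) * hd j) (sgn (s j)))
      (trans (cong₂ _*_ (0≤p⇒∣p∣≡p (*-nonneg (0≤𝟙 (hit h j)) (headPart-nonneg j))) (∣sgn∣ (s j))) (*-identityʳ _))

  -- At j = i the collision is certain, so the bound needs the weight to vanish there.
  scaled-collision : ∀ j {x} → 0ℚ ≤ x → (j ≡ i → x ≡ 0ℚ) → EH (λ h → 𝟙 (hit h j) * x) ≤ inv w * x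
  scaled-collision j {x} x≥0 x-self with j Finₚ.≟ i
  ... | no j≢i = ≤-trans (≤-reflexive (Ex-*ʳ (allFun n (allFin w)) x (λ h → 𝟙 (hit h j))))
          (*-monoʳ x≥0 (collision n w j i j≢i))
  ... | yes j≡i = ≤-trans
          (Ex-≤const (allFun n (allFin w)) ≤-refl (λ h → ≤-reflexive (trans (cong (𝟙 (hit h j) *_) (x-self j≡i)) (*-zeroʳ (𝟙 (hit h j))))))
          (*-nonneg (0≤inv w) x≥0)

  module _ (tail² : sumFin n (λ j → tl j * tl j) ≤ inv w) where

    Ex-∣tailNoise∣ : Ex (allRows n w) (∣_∣ ∘ tailNoise) ≤ inv w + inv w
    Ex-∣tailNoise∣ = begin
      Ex (allRows n w) (∣_∣ ∘ tailNoise)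
        ≤⟨ Ex-mono (allRows n w) (λ r → am-gm (tailNoise r)) ⟩
      Ex (allRows n w) (λ r → ℕtoℚ w * (tailNoise r * tailNoise r) + inv w)
        ≡⟨ trans (Ex-+ (allRows n w) _ (λ _ → inv w))
             (cong (_+ Ex (allRows n w) (λ _ → inv w)) (Ex-*ˡ (allRows n w) (ℕtoℚ w) _)) ⟩
      ℕtoℚ w * Ex (allRows n w) (λ r → tailNoise r * tailNoise r) + Ex (allRows n w) (λ _ → inv w)
        ≤⟨ +-mono-≤ (*-monoˡ (0≤ℕtoℚ w) second-moment) (Ex-const≤ (allRows n w) (0≤inv w)) ⟩
      ℕtoℚ w * (inv w * inv w) + inv w
        ≡⟨ cong (_+ inv w) (trans (sym (*-assoc (ℕtoℚ w) (inv w) (inv w)))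
             (trans (cong (_* inv w) (ℕtoℚ*inv w)) (*-identityˡ (inv w)))) ⟩
      inv w + inv w ∎
      where
      open ≤-Reasoning
      -- This passes from the second moment to the first without a square root. The weight `w`
      -- matches E Z² ≤ 1/w², so that both summands have expectation at most 1/w; the slack is w(|z|
      -- - 1/w)² + |z|.
      am-gm : ∀ z → ∣ z ∣ ≤ ℕtoℚ w * (z * z) + inv w
      am-gm z = ≤-by (+-nonneg (*-nonneg (0≤ℕtoℚ w) (sq-nonneg (y - inv w))) (0≤∣p∣ z)) (begin-equality
        ℕtoℚ w * (z * z) + inv w
          ≡⟨ cong (λ x → ℕtoℚ w * x + inv w) (sym ∣z∣²) ⟩
        ℕtoℚ w * (y * y) + inv w
          ≡⟨ lem (ℕtoℚ w) (inv w) y ⟩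
        y + (ℕtoℚ w * ((y - inv w) * (y - inv w)) + y) + (ℕtoℚ w * inv w - 1ℚ) * (y + y - inv w)
          ≡⟨ cong (λ x → y + (ℕtoℚ w * ((y - inv w) * (y - inv w)) + y) + (x - 1ℚ) * (y + y - inv w)) (ℕtoℚ*inv w) ⟩
        y + (ℕtoℚ w * ((y - inv w) * (y - inv w)) + y) + (1ℚ - 1ℚ) * (y + y - inv w)
          ≡⟨ lem′ (y + (ℕtoℚ w * ((y - inv w) * (y - inv w)) + y)) (y + y - inv w) ⟩
        y + (ℕtoℚ w * ((y - inv w) * (y - inv w)) + y) ∎)
        where
        y = ∣ z ∣
        ∣z∣² : ∣ z ∣ * ∣ z ∣ ≡ z * z
        ∣z∣² = trans (sym (∣p*q∣≡∣p∣*∣q∣ z z)) (0≤p⇒∣p∣≡p (sq-nonneg z))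
        lem : ∀ k v y → k * (y * y) + v ≡ y + (k * ((y - v) * (y - v)) + y) + (k * v - 1ℚ) * (y + y - v)
        lem = solve-∀ ℚ-ring
        lem′ : ∀ x y → x + (1ℚ - 1ℚ) * y ≡ x
        lem′ = solve-∀ ℚ-ring
      coef : (Fin n → Fin w) → Fin n → ℚ
      coef h j = 𝟙 (hit h j) * tl j
      idem : ∀ b x → (𝟙 b * x) * (𝟙 b * x) ≡ 𝟙 b * (x * x)
      idem true = l
        where
        l : ∀ x → (1ℚ * x) * (1ℚ * x) ≡ 1ℚ * (x * x)
        l = solve-∀ ℚ-ring
      idem false = l
        where
        l : ∀ x → (0ℚ * x) * (0ℚ * x) ≡ 0ℚ * (x * x)
        l = solve-∀ ℚ-ring
      second-moment : Ex (allRows n w) (λ r → tailNoise r * tailNoise r) ≤ inv w * inv w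
      second-moment = begin
        Ex (allRows n w) (λ r → tailNoise r * tailNoise r)
          ≡⟨ Ex-allPairs (allFun n (allFin w)) (allFun n bools) _ ⟩
        -- For fixed `h` the average over the signs removes all cross terms; only then are the
        -- hashes averaged.
        EH (λ h → Ex (allFun n bools) (λ s → tailNoise (h , s) * tailNoise (h , s)))
          ≤⟨ Ex-mono (allFun n (allFin w)) (λ h → ≤-trans
               (≤-reflexive (Ex-cong (allFun n bools) (λ s → cong (λ x → x * x) (sym (+-identityˡ (tailNoise (h , s)))))))
               (≤-trans (sign-second-moment n 0ℚ (coef h)) (≤-reflexive (+-identityˡ _)))) ⟩
        EH (λ h → sumFin n (λ j → coef h j * coef h j))
          ≡⟨ Ex-sumFin (allFun n (allFin w)) n (λ j h → coef h j * coef h j) ⟩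
        sumFin n (λ j → EH (λ h → coef h j * coef h j))
          ≤⟨ sumFin-mono n (λ j → ≤-trans
               (≤-reflexive (Ex-cong (allFun n (allFin w)) (λ h → idem (hit h j) (tl j))))
               (scaled-collision j (sq-nonneg (tl j)) (λ j≡i → cong (λ x → x * x) (tailPart-self j j≡i)))) ⟩
        sumFin n (λ j → inv w * (tl j * tl j))
          ≡⟨ sumFin-*ˡ n (inv w) (λ j → tl j * tl j) ⟩
        inv w * sumFin n (λ j → tl j * tl j)
          ≤⟨ *-monoˡ (0≤inv w) tail² ⟩
        inv w * inv w ∎

    module _ (head⊓ : sumFin n (λ j → sumFin n (λ l → hd j ⊓ hd l)) ≤ ℕtoℚ w + ℕtoℚ w) where

      -- Of the 6/w, the head accounts for 2w · w⁻² = 2/w, and the tail noise of each of the two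
      -- rows for another 2/w.
      Ex-rowErr-⊓ : Ex (allRows n w) (λ r → Ex (allRows n w) (λ r′ → rowErr f i r ⊓ rowErr f i r′))
        ≤ ℕtoℚ 6 * inv w
      Ex-rowErr-⊓ = begin
        Ex (allRows n w) (λ r → Ex (allRows n w) (λ r′ → rowErr f i r ⊓ rowErr f i r′))
          ≤⟨ Ex-mono (allRows n w) inner ⟩
        Ex (allRows n w) (λ r → P r + (∣ tailNoise r ∣ + (inv w + inv w)))
          ≡⟨ trans (Ex-+ (allRows n w) P _) (cong (Ex (allRows n w) P +_) (Ex-+ (allRows n w) (∣_∣ ∘ tailNoise) _)) ⟩
        Ex (allRows n w) P + (Ex (allRows n w) (∣_∣ ∘ tailNoise) + Ex (allRows n w) (λ _ → inv w + inv w))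
          ≤⟨ +-mono-≤ outer (+-mono-≤ Ex-∣tailNoise∣ (Ex-const≤ (allRows n w) (+-nonneg (0≤inv w) (0≤inv w)))) ⟩
        inv w * (inv w * (ℕtoℚ w + ℕtoℚ w)) + ((inv w + inv w) + (inv w + inv w))
          ≡⟨ lem (inv w) (ℕtoℚ w) ⟩
        (ℕtoℚ w * inv w) * (inv w + inv w) + ((inv w + inv w) + (inv w + inv w))
          ≡⟨ cong (λ x → x * (inv w + inv w) + ((inv w + inv w) + (inv w + inv w))) (ℕtoℚ*inv w) ⟩
        1ℚ * (inv w + inv w) + ((inv w + inv w) + (inv w + inv w))
          ≡⟨ lem′ (inv w) ⟩
        ℕtoℚ 6 * inv w ∎
        where
        open ≤-Reasoning
        m : Fin n → Fin n → ℚ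
        m j l = hd j ⊓ hd l
        m≥0 : ∀ j l → 0ℚ ≤ m j l
        m≥0 j l = ⊓-nonneg (headPart-nonneg j) (headPart-nonneg l)
        m-selfˡ : ∀ j l → j ≡ i → m j l ≡ 0ℚ
        m-selfˡ j l j≡i = trans (cong (_⊓ hd l) (headPart-self j j≡i)) (p≤q⇒p⊓q≡p (headPart-nonneg l))
        m-selfʳ : ∀ j l → l ≡ i → m j l ≡ 0ℚ
        m-selfʳ j l l≡i = trans (cong (hd j ⊓_) (headPart-self l l≡i)) (p≥q⇒p⊓q≡q (headPart-nonneg j))
        Q : Row n w → Row n w → ℚ
        Q (h , _) (h′ , _) = sumFin n (λ j → sumFin n (λ l → 𝟙 (hit h j) * (𝟙 (hit h′ l) * m j l)))
        -- `P r` bounds the average of `Q r` over the second row: the second collision indicator is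
        -- replaced by `inv w`.
        P : Row n w → ℚ
        P (h , _) = sumFin n (λ j → sumFin n (λ l → 𝟙 (hit h j) * (inv w * m j l)))
        EH-proj : {X : (Fin n → Fin w) → ℚ} → (∀ h → 0ℚ ≤ X h) → Ex (allRows n w) (X ∘ proj₁) ≤ EH X
        EH-proj X≥0 = ≤-trans (≤-reflexive (Ex-allPairs (allFun n (allFin w)) (allFun n bools) _))
          (Ex-mono (allFun n (allFin w)) (λ h → Ex-const≤ (allFun n bools) (X≥0 h)))
        pointwise : ∀ r r′ → rowErr f i r ⊓ rowErr f i r′ ≤ Q r r′ + (∣ tailNoise r ∣ + ∣ tailNoise r′ ∣)
        pointwise r@(h , _) r′@(h′ , _) = ≤-trans (⊓-mono-≤ (rowErr≤noise r) (rowErr≤noise r′))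
          (≤-trans (⊓-perturb (headNoise r) (headNoise r′) (0≤∣p∣ (tailNoise r)) (0≤∣p∣ (tailNoise r′)))
            (+-monoˡ-≤ _ (≤-trans
              (sumFin-⊓ n n _ _ (λ j → *-nonneg (0≤𝟙 (hit h j)) (headPart-nonneg j))
                                (λ l → *-nonneg (0≤𝟙 (hit h′ l)) (headPart-nonneg l)))
              (sumFin-mono n λ j → sumFin-mono n λ l →
                𝟙-⊓ (hit h j) (hit h′ l) (headPart-nonneg j) (headPart-nonneg l)))))
        ExQ : ∀ r → Ex (allRows n w) (Q r) ≤ P r
        ExQ r@(h , _) = begin
          Ex (allRows n w) (Q r)
            ≤⟨ EH-proj (λ h′ → sumFin-nonneg n λ j → sumFin-nonneg n λ l →
                 *-nonneg (0≤𝟙 (hit h j)) (*-nonneg (0≤𝟙 (hit h′ l)) (m≥0 j l))) ⟩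
          EH (λ h′ → sumFin n (λ j → sumFin n (λ l → 𝟙 (hit h j) * (𝟙 (hit h′ l) * m j l))))
            ≡⟨ trans (Ex-sumFin (allFun n (allFin w)) n _) (sumFin-cong n λ j → Ex-sumFin (allFun n (allFin w)) n _) ⟩
          sumFin n (λ j → sumFin n (λ l → EH (λ h′ → 𝟙 (hit h j) * (𝟙 (hit h′ l) * m j l))))
            ≤⟨ sumFin-mono n (λ j → sumFin-mono n λ l → ≤-trans
                 (≤-reflexive (Ex-*ˡ (allFun n (allFin w)) (𝟙 (hit h j)) _))
                 (*-monoˡ (0≤𝟙 (hit h j)) (scaled-collision l (m≥0 j l) (m-selfʳ j l)))) ⟩
          P r ∎
        inner : ∀ r → Ex (allRows n w) (λ r′ → rowErr f i r ⊓ rowErr f i r′)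
          ≤ P r + (∣ tailNoise r ∣ + (inv w + inv w))
        inner r = ≤-trans (Ex-mono (allRows n w) (pointwise r))
          (≤-trans (≤-reflexive (trans (Ex-+ (allRows n w) (Q r) _)
              (cong (Ex (allRows n w) (Q r) +_) (Ex-+ (allRows n w) (λ _ → ∣ tailNoise r ∣) (∣_∣ ∘ tailNoise)))))
            (+-mono-≤ (ExQ r) (+-mono-≤ (Ex-const≤ (allRows n w) (0≤∣p∣ (tailNoise r))) Ex-∣tailNoise∣)))
        outer : Ex (allRows n w) P ≤ inv w * (inv w * (ℕtoℚ w + ℕtoℚ w))
        outer = begin
          Ex (allRows n w) P
            ≤⟨ EH-proj (λ h → sumFin-nonneg n λ j → sumFin-nonneg n λ l →
                 *-nonneg (0≤𝟙 (hit h j)) (*-nonneg (0≤inv w) (m≥0 j l))) ⟩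
          EH (λ h → sumFin n (λ j → sumFin n (λ l → 𝟙 (hit h j) * (inv w * m j l))))
            ≡⟨ trans (Ex-sumFin (allFun n (allFin w)) n _) (sumFin-cong n λ j → Ex-sumFin (allFun n (allFin w)) n _) ⟩
          sumFin n (λ j → sumFin n (λ l → EH (λ h → 𝟙 (hit h j) * (inv w * m j l))))
            ≤⟨ sumFin-mono n (λ j → sumFin-mono n λ l →
                 scaled-collision j (*-nonneg (0≤inv w) (m≥0 j l))
                   (λ j≡i → trans (cong (inv w *_) (m-selfˡ j l j≡i)) (*-zeroʳ (inv w)))) ⟩
          sumFin n (λ j → sumFin n (λ l → inv w * (inv w * m j l)))
            ≡⟨ trans (sumFin-cong n (λ j → trans (sumFin-*ˡ n (inv w) _) (cong (inv w *_) (sumFin-*ˡ n (inv w) (m j)))))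
                 (trans (sumFin-*ˡ n (inv w) _) (cong (inv w *_) (sumFin-*ˡ n (inv w) _))) ⟩
          inv w * (inv w * sumFin n (λ j → sumFin n (m j)))
            ≤⟨ *-monoˡ (0≤inv w) (*-monoˡ (0≤inv w) head⊓) ⟩
          inv w * (inv w * (ℕtoℚ w + ℕtoℚ w)) ∎
        lem : ∀ v k → v * (v * (k + k)) + ((v + v) + (v + v)) ≡ (k * v) * (v + v) + ((v + v) + (v + v))
        lem = solve-∀ ℚ-ring
        lem′ : ∀ v → 1ℚ * (v + v) + ((v + v) + (v + v)) ≡ (ℤ.+ 6 / 1) * v
        lem′ = solve-∀ ℚ-ring

      Ex-tableErr : Ex (allTables n w) (tableErr f i) ≤ ℕtoℚ 54 * inv w
      Ex-tableErr = begin
        Ex (allTables n w) (tableErr f i)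
          ≤⟨ Ex-mono (allTables n w) (median₃-error (λ r → rowEst f r i) (f i)) ⟩
        Ex (allVec 3 (allRows n w)) (pairSum (λ r r′ → rowErr f i r ⊓ rowErr f i r′))
          ≤⟨ Ex-pairSum _ (λ r r′ → ⊓-nonneg (0≤∣p∣ (rowEst f r i - f i)) (0≤∣p∣ (rowEst f r′ i - f i)))
               (allRows n w) 3 Ex-rowErr-⊓ ⟩
        -- This is the origin of 54 = 3² · 6, where 3² is the pair count of `Ex-pairSum` for three
        -- rows.
        ℕtoℚ 3 * ℕtoℚ 3 * (ℕtoℚ 6 * inv w)
          ≡⟨ lem (inv w) ⟩
        ℕtoℚ 54 * inv w ∎
        where
        open ≤-Reasoning
        lem : ∀ v → (ℤ.+ 3 / 1) * (ℤ.+ 3 / 1) * ((ℤ.+ 6 / 1) * v) ≡ (ℤ.+ 54 / 1) * v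
        lem = solve-∀ ℚ-ring

-- Zipfian and harmonic sums

inv-antitone : ∀ {a b} .{{_ : NonZero a}} → a ℕ.≤ b → inv b ≤ inv a
inv-antitone {a} {b} a≤b = cancelˡ a (≤-trans (*-monoʳ (0≤inv b) (ℕtoℚ-mono a≤b))
  (≤-trans (ℕtoℚ*inv≤1 b) (≤-reflexive (sym (ℕtoℚ*inv a)))))

inv-scale : ∀ {w B} K .{{_ : NonZero w}} .{{_ : NonZero B}} → B ℕ.≤ w ℕ.* K → inv w ≤ ℕtoℚ K * inv B
inv-scale {w} {B} K B≤wK = cancelˡ w (begin
  ℕtoℚ w * inv w              ≡⟨ trans (ℕtoℚ*inv w) (sym (ℕtoℚ*inv B)) ⟩
  ℕtoℚ B * inv B              ≤⟨ *-monoʳ (0≤inv B) (ℕtoℚ-mono B≤wK) ⟩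
  ℕtoℚ (w ℕ.* K) * inv B      ≡⟨ trans (cong (_* inv B) (ℕtoℚ-* w K)) (*-assoc (ℕtoℚ w) (ℕtoℚ K) (inv B)) ⟩
  ℕtoℚ w * (ℕtoℚ K * inv B) ∎)
  where open ≤-Reasoning

-- The telescoping step 1/(a+1)² ≤ 1/a - 1/(a+1), arranged without subtraction.
inv²-step : ∀ a .{{_ : NonZero a}} → inv (suc a) * inv (suc a) + inv (suc a) ≤ inv a
inv²-step a = cancelˡ a (begin
  ℕtoℚ a * (x * x + x)             ≤⟨ ≤-by (sq-nonneg x) (lem (ℕtoℚ a) x) ⟩
  ((1ℚ + ℕtoℚ a) * x) * (1ℚ + x) - x   ≡⟨ cong (λ y → y * (1ℚ + x) - x) (trans (cong (_* x) (sym (ℕtoℚ-suc a))) (ℕtoℚ*inv (suc a))) ⟩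
  1ℚ * (1ℚ + x) - x                ≡⟨ lem′ x ⟩
  1ℚ                               ≡⟨ sym (ℕtoℚ*inv a) ⟩
  ℕtoℚ a * inv a ∎)
  where
  open ≤-Reasoning
  x = inv (suc a)
  lem : ∀ k x → ((1ℚ + k) * x) * (1ℚ + x) - x ≡ k * (x * x + x) + x * x
  lem = solve-∀ ℚ-ring
  lem′ : ∀ x → 1ℚ * (1ℚ + x) - x ≡ 1ℚ
  lem′ = solve-∀ ℚ-ring

sum-inv² : ∀ n a .{{_ : NonZero a}} →
  sumFin n (λ j → inv (suc (a ℕ.+ toℕ j)) * inv (suc (a ℕ.+ toℕ j))) ≤ inv a
sum-inv² zero a = 0≤inv a
sum-inv² (suc n) a = ≤-trans (+-mono-≤
  (≤-reflexive (cong (λ k → inv (suc k) * inv (suc k)) (ℕₚ.+-identityʳ a)))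
  (≤-trans (≤-reflexive (sumFin-cong n (λ j → cong (λ k → inv (suc k) * inv (suc k)) (ℕₚ.+-suc a (toℕ j)))))
    (sum-inv² n (suc a)))) (inv²-step a)

-- Here `w` counts the entries still to be skipped and `a` those already passed; their sum is
-- invariant in the induction and becomes the starting point of the tail.
sum-inv²-from : ∀ n w a .{{_ : NonZero (w ℕ.+ a)}} →
  sumFin n (λ j → (if toℕ j ℕ.<ᵇ w then 0ℚ else inv (suc (a ℕ.+ toℕ j))) *
                  (if toℕ j ℕ.<ᵇ w then 0ℚ else inv (suc (a ℕ.+ toℕ j)))) ≤ inv (w ℕ.+ a)
sum-inv²-from zero w a = 0≤inv (w ℕ.+ a)
sum-inv²-from (suc n) zero a = sum-inv² (suc n) a
sum-inv²-from (suc n) (suc w) a = begin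
  0ℚ * 0ℚ + sumFin n (λ j → g (a ℕ.+ suc (toℕ j)) j * g (a ℕ.+ suc (toℕ j)) j)
    ≡⟨ trans (+-identityˡ _) (sumFin-cong n (λ j → cong (λ k → g k j * g k j) (ℕₚ.+-suc a (toℕ j)))) ⟩
  sumFin n (λ j → g (suc a ℕ.+ toℕ j) j * g (suc a ℕ.+ toℕ j) j)
    ≤⟨ sum-inv²-from n w (suc a) {{nz}} ⟩
  inv (w ℕ.+ suc a)
    ≡⟨ cong inv (ℕₚ.+-suc w a) ⟩
  inv (suc w ℕ.+ a) ∎
  where
  open ≤-Reasoning
  g : ℕ → Fin n → ℚ
  g k j = if toℕ j ℕ.<ᵇ w then 0ℚ else inv (suc k)
  nz : NonZero (w ℕ.+ suc a)
  nz = subst NonZero (sym (ℕₚ.+-suc w a)) _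

zipf≥0 : ∀ n j → 0ℚ ≤ zipf n j
zipf≥0 n j = 0≤inv (suc (toℕ j))

if-sq-≤ : ∀ b x → (if b then 0ℚ else x) * (if b then 0ℚ else x) ≤ x * x
if-sq-≤ true x = sq-nonneg x
if-sq-≤ false x = ≤-refl

zipf-beyond : ∀ n w .{{_ : NonZero w}} →
  sumFin n (λ j → (if toℕ j ℕ.<ᵇ w then 0ℚ else zipf n j) * (if toℕ j ℕ.<ᵇ w then 0ℚ else zipf n j)) ≤ inv w
zipf-beyond n w {{w≢0}} = ≤-trans (sum-inv²-from n w 0 {{nz}}) (≤-reflexive (cong inv (ℕₚ.+-identityʳ w)))
  where
  nz : NonZero (w ℕ.+ 0)
  nz = subst NonZero (sym (ℕₚ.+-identityʳ w)) (ℕ.≢-nonZero (ℕ.≢-nonZero⁻¹ w))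

zipf-tail² : ∀ n w .{{_ : NonZero w}} i →
  sumFin n (λ j → tailPart w (zipf n) i j * tailPart w (zipf n) i j) ≤ inv w
zipf-tail² n w i = ≤-trans (sumFin-mono n (λ j → if-sq-≤ (does (j Finₚ.≟ i)) _)) (zipf-beyond n w)

sum-𝟙< : ∀ n m → sumFin n (λ j → 𝟙 (toℕ j ℕ.<ᵇ m)) ≤ ℕtoℚ m
sum-𝟙< zero m = 0≤ℕtoℚ m
sum-𝟙< (suc n) zero = ≤-reflexive (trans (+-identityˡ _) (sumFin-zero n))
sum-𝟙< (suc n) (suc m) = ≤-trans (+-monoʳ-≤ 1ℚ (sum-𝟙< n m)) (≤-reflexive (sym (ℕtoℚ-suc m)))

T⇒≡true : ∀ {b} → T b → b ≡ true
T⇒≡true {true} _ = refl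

-- Each minimum is charged to the larger index. Rank l is charged by the l ranks up to l at price
-- 1/l, so a column of `p` costs at most 1, and nothing beyond rank w. The two triangles `p j l` and
-- `p l j` give 2w.
zipf-head⊓ : ∀ n w i →
  sumFin n (λ j → sumFin n (λ l → headPart w (zipf n) i j ⊓ headPart w (zipf n) i l)) ≤ ℕtoℚ w + ℕtoℚ w
zipf-head⊓ n w i = begin
  sumFin n (λ j → sumFin n (λ l → hd j ⊓ hd l))
    ≤⟨ sumFin-mono n (λ j → sumFin-mono n (pointwise j)) ⟩
  sumFin n (λ j → sumFin n (λ l → p j l + p l j))
    ≡⟨ trans (sumFin-cong n (λ j → sumFin-+ n (p j) (λ l → p l j))) (sumFin-+ n _ _) ⟩
  sumFin n (λ j → sumFin n (p j)) + sumFin n (λ j → sumFin n (λ l → p l j))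
    ≤⟨ +-mono-≤ (≤-trans (≤-reflexive (sumFin-swap n n p)) columns) columns ⟩
  ℕtoℚ w + ℕtoℚ w ∎
  where
  open ≤-Reasoning
  hd h : Fin n → ℚ
  hd = headPart w (zipf n) i
  h l = if toℕ l ℕ.<ᵇ w then zipf n l else 0ℚ
  h≥0 : ∀ l → 0ℚ ≤ h l
  h≥0 l with toℕ l ℕ.<ᵇ w
  ... | true = zipf≥0 n l
  ... | false = ≤-refl
  hd≤h : ∀ l → hd l ≤ h l
  hd≤h l with does (l Finₚ.≟ i)
  ... | true = h≥0 l
  ... | false = ≤-refl
  p : Fin n → Fin n → ℚ
  p j l = 𝟙 (toℕ j ℕ.<ᵇ suc (toℕ l)) * h l
  p≥0 : ∀ j l → 0ℚ ≤ p j l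
  p≥0 j l = *-nonneg (0≤𝟙 (toℕ j ℕ.<ᵇ suc (toℕ l))) (h≥0 l)
  p≡h : ∀ j l → toℕ j ℕ.≤ toℕ l → p j l ≡ h l
  p≡h j l j≤l = trans (cong (λ b → 𝟙 b * h l) (T⇒≡true (ℕₚ.<⇒<ᵇ (s≤s j≤l)))) (*-identityˡ (h l))
  pointwise : ∀ j l → hd j ⊓ hd l ≤ p j l + p l j
  pointwise j l with ℕₚ.≤-total (toℕ j) (toℕ l)
  ... | inj₁ j≤l = ≤-trans (p⊓q≤q (hd j) (hd l)) (≤-trans (hd≤h l)
          (≤-trans (≤-reflexive (sym (p≡h j l j≤l))) (p≤p+q (p≥0 l j))))
  ... | inj₂ l≤j = ≤-trans (p⊓q≤p (hd j) (hd l)) (≤-trans (hd≤h j)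
          (≤-trans (≤-reflexive (sym (p≡h l j l≤j))) (p≤q+p (p≥0 j l))))
  column : ∀ l → sumFin n (λ j → p j l) ≤ 𝟙 (toℕ l ℕ.<ᵇ w)
  column l = ≤-trans (≤-reflexive (sumFin-*ʳ n (h l) _))
    (≤-trans (*-monoʳ (h≥0 l) (sum-𝟙< n (suc (toℕ l)))) last)
    where
    last : ℕtoℚ (suc (toℕ l)) * h l ≤ 𝟙 (toℕ l ℕ.<ᵇ w)
    last with toℕ l ℕ.<ᵇ w
    ... | true = ≤-reflexive (ℕtoℚ*inv (suc (toℕ l)))
    ... | false = ≤-reflexive (*-zeroʳ (ℕtoℚ (suc (toℕ l))))
  columns : sumFin n (λ l → sumFin n (λ j → p j l)) ≤ ℕtoℚ w
  columns = ≤-trans (sumFin-mono n column) (sum-𝟙< n w)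

-- Harmonic numbers and logarithms

harmonic : ℕ → ℚ
harmonic zero = 0ℚ
harmonic (suc k) = harmonic k + inv (suc k)

harmonic-mono : ∀ {a b} → a ℕ.≤ b → harmonic a ≤ harmonic b
harmonic-mono {a} {b} a≤b = subst (λ k → harmonic a ≤ harmonic k) (ℕₚ.m∸n+n≡m a≤b) (go (b ℕ.∸ a))
  where
  go : ∀ d → harmonic a ≤ harmonic (d ℕ.+ a)
  go zero = ≤-refl
  go (suc d) = ≤-trans (go d) (p≤p+q (0≤inv (suc (d ℕ.+ a))))

-- `sumFin` peels off the first term while `harmonic` appends the last one; the offset `a`
-- reconciles the two recursions.
sumFin-harmonic : ∀ n a → harmonic a + sumFin n (λ j → inv (suc (a ℕ.+ toℕ j))) ≡ harmonic (a ℕ.+ n)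
sumFin-harmonic zero a = trans (+-identityʳ _) (cong harmonic (sym (ℕₚ.+-identityʳ a)))
sumFin-harmonic (suc n) a = trans (sym (+-assoc (harmonic a) _ _))
  (trans (cong₂ _+_ (cong (λ k → harmonic a + inv (suc k)) (ℕₚ.+-identityʳ a))
            (sumFin-cong n (λ j → cong (λ k → inv (suc k)) (ℕₚ.+-suc a (toℕ j)))))
    (trans (sumFin-harmonic n (suc a)) (cong harmonic (sym (ℕₚ.+-suc a n)))))

totalN≡harmonic : ∀ n → totalN n ≡ harmonic n
totalN≡harmonic n = trans (sym (+-identityˡ _)) (sumFin-harmonic n 0)

sumFin-harmonic-upto : ∀ n B a →
  harmonic a + sumFin n (λ j → if toℕ j ℕ.<ᵇ B then inv (suc (a ℕ.+ toℕ j)) else 0ℚ) ≤ harmonic (a ℕ.+ B)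
sumFin-harmonic-upto zero B a = ≤-trans (≤-reflexive (+-identityʳ _)) (harmonic-mono (ℕₚ.m≤m+n a B))
sumFin-harmonic-upto (suc n) zero a =
  ≤-reflexive (trans (cong (harmonic a +_) (sumFin-zero (suc n))) (trans (+-identityʳ _) (cong harmonic (sym (ℕₚ.+-identityʳ a)))))
sumFin-harmonic-upto (suc n) (suc B) a = ≤-trans
  (≤-reflexive (trans (sym (+-assoc (harmonic a) _ _))
    (cong₂ _+_ (cong (λ k → harmonic a + inv (suc k)) (ℕₚ.+-identityʳ a))
      (sumFin-cong n (λ j → cong (λ k → if toℕ j ℕ.<ᵇ B then inv (suc k) else 0ℚ) (ℕₚ.+-suc a (toℕ j)))))))
  (≤-trans (sumFin-harmonic-upto n B (suc a)) (≤-reflexive (cong harmonic (sym (ℕₚ.+-suc a B)))))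

zipf-upto : ∀ n B → sumFin n (λ j → if toℕ j ℕ.<ᵇ B then zipf n j else 0ℚ) ≤ harmonic B
zipf-upto n B = ≤-trans (≤-reflexive (sym (+-identityˡ _))) (sumFin-harmonic-upto n B 0)

-- Raising `b` by one adds two terms on the left, each at most 1/(2b+2), against 1/(b+1) on the
-- right. The odd index 2b+1 covers both parities when a number is halved.
harmonic-double : ∀ b → harmonic (suc (b ℕ.+ b)) ≤ 1ℚ + harmonic b
harmonic-double zero = ≤-refl
harmonic-double (suc b) rewrite ℕₚ.+-suc b b = begin
  harmonic (suc (b ℕ.+ b)) + inv (2 ℕ.+ (b ℕ.+ b)) + inv (3 ℕ.+ (b ℕ.+ b))
    ≤⟨ +-mono-≤ (+-monoˡ-≤ _ (harmonic-double b)) (inv-antitone (ℕₚ.n≤1+n (2 ℕ.+ (b ℕ.+ b)))) ⟩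
  1ℚ + harmonic b + inv (2 ℕ.+ (b ℕ.+ b)) + inv (2 ℕ.+ (b ℕ.+ b))
    ≡⟨ trans (lem (harmonic b) (inv (2 ℕ.+ (b ℕ.+ b)))) (cong (λ x → 1ℚ + (harmonic b + x)) double) ⟩
  1ℚ + (harmonic b + inv (suc b)) ∎
  where
  open ≤-Reasoning
  lem : ∀ h x → 1ℚ + h + x + x ≡ 1ℚ + (h + ((ℤ.+ 2 / 1) * x))
  lem = solve-∀ ℚ-ring
  double : ℕtoℚ 2 * inv (2 ℕ.+ (b ℕ.+ b)) ≡ inv (suc b)
  double = trans (cong (λ k → ℕtoℚ 2 * inv k) (trans (cong suc (sym (ℕₚ.+-suc b b))) (cong (suc b ℕ.+_) (sym (ℕₚ.+-identityʳ (suc b))))))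
    (trans (cong (ℕtoℚ 2 *_) (inv-* 2 (suc b)))
      (trans (sym (*-assoc (ℕtoℚ 2) (inv 2) (inv (suc b)))) (*-identityˡ (inv (suc b)))))

n≤1+2⌊n/2⌋ : ∀ n → n ℕ.≤ suc (ℕ.⌊ n /2⌋ ℕ.+ ℕ.⌊ n /2⌋)
n≤1+2⌊n/2⌋ zero = z≤n
n≤1+2⌊n/2⌋ (suc zero) = ℕₚ.≤-refl
n≤1+2⌊n/2⌋ (suc (suc n)) = s≤s (ℕₚ.≤-trans (s≤s (n≤1+2⌊n/2⌋ n)) (ℕₚ.≤-reflexive (cong suc (sym (ℕₚ.+-suc _ _)))))

2⌊n/2⌋≤n : ∀ n → ℕ.⌊ n /2⌋ ℕ.+ ℕ.⌊ n /2⌋ ℕ.≤ n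
2⌊n/2⌋≤n zero = z≤n
2⌊n/2⌋≤n (suc zero) = z≤n
2⌊n/2⌋≤n (suc (suc n)) = s≤s (ℕₚ.≤-trans (ℕₚ.≤-reflexive (ℕₚ.+-suc _ _)) (s≤s (2⌊n/2⌋≤n n)))

⌊log₂⌋-halve : ∀ n → ⌊log₂ (2 ℕ.+ n) ⌋ ≡ suc ⌊log₂ suc ℕ.⌊ n /2⌋ ⌋
⌊log₂⌋-halve n = sym (trans (cong suc (⌊log₂⌊n/2⌋⌋≡⌊log₂n⌋∸1 (2 ℕ.+ n)))
  (ℕₚ.m+[n∸m]≡n (⌊log₂⌋-mono-≤ {2} {2 ℕ.+ n} (s≤s (s≤s z≤n)))))

harmonic≤1+log : ∀ m → harmonic m ≤ 1ℚ + ℕtoℚ ⌊log₂ m ⌋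
harmonic≤1+log m = go m m ℕₚ.≤-refl
  where
  open ≤-Reasoning
  go : ∀ fuel m → m ℕ.≤ fuel → harmonic m ≤ 1ℚ + ℕtoℚ ⌊log₂ m ⌋
  go fuel zero _ = 0≤1
  go fuel (suc zero) _ = ≤-refl
  go (suc fuel) (suc (suc n)) (s≤s n<fuel) = begin
    harmonic (2 ℕ.+ n)
      ≤⟨ harmonic-mono (n≤1+2⌊n/2⌋ (2 ℕ.+ n)) ⟩
    harmonic (suc (ℕ.⌊ 2 ℕ.+ n /2⌋ ℕ.+ ℕ.⌊ 2 ℕ.+ n /2⌋))
      ≤⟨ harmonic-double (ℕ.⌊ 2 ℕ.+ n /2⌋) ⟩
    1ℚ + harmonic (suc ℕ.⌊ n /2⌋)
      ≤⟨ +-monoʳ-≤ 1ℚ (go fuel (suc ℕ.⌊ n /2⌋) (ℕₚ.≤-trans (s≤s (ℕₚ.⌊n/2⌋≤n n)) n<fuel)) ⟩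
    1ℚ + (1ℚ + ℕtoℚ ⌊log₂ suc ℕ.⌊ n /2⌋ ⌋)
      ≡⟨ cong (1ℚ +_) (sym (trans (cong ℕtoℚ (⌊log₂⌋-halve n)) (ℕtoℚ-suc ⌊log₂ suc ℕ.⌊ n /2⌋ ⌋))) ⟩
    1ℚ + ℕtoℚ ⌊log₂ (2 ℕ.+ n) ⌋ ∎

2^⌊log₂n⌋≤n : ∀ n .{{_ : NonZero n}} → 2 ℕ.^ ⌊log₂ n ⌋ ℕ.≤ n
2^⌊log₂n⌋≤n n = go n n ℕₚ.≤-refl
  where
  open ℕₚ.≤-Reasoning
  go : ∀ fuel n .{{_ : NonZero n}} → n ℕ.≤ fuel → 2 ℕ.^ ⌊log₂ n ⌋ ℕ.≤ n
  go fuel (suc zero) _ = ℕₚ.≤-refl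
  go (suc fuel) (suc (suc n)) (s≤s n<fuel) = begin
    2 ℕ.^ ⌊log₂ (2 ℕ.+ n) ⌋                 ≡⟨ cong (2 ℕ.^_) (⌊log₂⌋-halve n) ⟩
    2 ℕ.* 2 ℕ.^ ⌊log₂ suc ℕ.⌊ n /2⌋ ⌋       ≤⟨ ℕₚ.*-monoʳ-≤ 2 (go fuel (suc ℕ.⌊ n /2⌋) (ℕₚ.≤-trans (s≤s (ℕₚ.⌊n/2⌋≤n n)) n<fuel)) ⟩
    2 ℕ.* suc ℕ.⌊ n /2⌋                     ≡⟨ cong (suc ℕ.⌊ n /2⌋ ℕ.+_) (ℕₚ.+-identityʳ (suc ℕ.⌊ n /2⌋)) ⟩
    suc ℕ.⌊ n /2⌋ ℕ.+ suc ℕ.⌊ n /2⌋         ≤⟨ 2⌊n/2⌋≤n (2 ℕ.+ n) ⟩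
    2 ℕ.+ n ∎

n<2^[1+⌊log₂n⌋] : ∀ n → n ℕ.< 2 ℕ.^ suc ⌊log₂ n ⌋
n<2^[1+⌊log₂n⌋] n = ℕₚ.≰⇒> λ 2^≤n → ℕₚ.<-irrefl refl
  (ℕₚ.≤-trans (ℕₚ.≤-reflexive (sym (⌊log₂[2^n]⌋≡n (suc ⌊log₂ n ⌋)))) (⌊log₂⌋-mono-≤ 2^≤n))

harmonic-block : ∀ a b {k} → a ℕ.+ b ℕ.≤ k → harmonic a + ℕtoℚ b * inv k ≤ harmonic (a ℕ.+ b)
harmonic-block a zero {k} _ = ≤-reflexive (trans (cong (harmonic a +_) (*-zeroˡ (inv k)))
  (trans (+-identityʳ _) (cong harmonic (sym (ℕₚ.+-identityʳ a)))))
harmonic-block a (suc b) {k} a+1+b≤k = begin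
  harmonic a + ℕtoℚ (suc b) * inv k
    ≡⟨ trans (cong (λ x → harmonic a + x * inv k) (ℕtoℚ-suc b)) (lem (harmonic a) (ℕtoℚ b) (inv k)) ⟩
  harmonic a + ℕtoℚ b * inv k + inv k
    ≤⟨ +-mono-≤ (harmonic-block a b (ℕₚ.<⇒≤ a+b<k)) (inv-antitone a+b<k) ⟩
  harmonic (suc (a ℕ.+ b))
    ≡⟨ cong harmonic (sym (ℕₚ.+-suc a b)) ⟩
  harmonic (a ℕ.+ suc b) ∎
  where
  open ≤-Reasoning
  lem : ∀ h k c → h + (1ℚ + k) * c ≡ h + k * c + c
  lem = solve-∀ ℚ-ring
  a+b<k : a ℕ.+ b ℕ.< k
  a+b<k = ℕₚ.≤-trans (ℕₚ.≤-reflexive (sym (ℕₚ.+-suc a b))) a+1+b≤k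

-- Oresme's argument: the 2^L terms from 2^L + 1 to 2^(L+1) are each at least 1/2^(L+1) and add at
-- least 1/2.
half-log≤harmonic : ∀ L → ℕtoℚ L * inv 2 ≤ harmonic (2 ℕ.^ L)
half-log≤harmonic zero = 0≤1
half-log≤harmonic (suc L) = begin
  ℕtoℚ (suc L) * inv 2                         ≡⟨ trans (cong (_* inv 2) (ℕtoℚ-suc L)) (lem (ℕtoℚ L)) ⟩
  ℕtoℚ L * inv 2 + inv 2                       ≤⟨ +-monoˡ-≤ (inv 2) (half-log≤harmonic L) ⟩
  harmonic (2 ℕ.^ L) + inv 2                   ≡⟨ cong (harmonic (2 ℕ.^ L) +_) (sym half) ⟩
  harmonic (2 ℕ.^ L) + ℕtoℚ (2 ℕ.^ L) * (inv 2 * inv (2 ℕ.^ L))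
    ≡⟨ cong (λ x → harmonic (2 ℕ.^ L) + ℕtoℚ (2 ℕ.^ L) * x) (sym (inv-* 2 (2 ℕ.^ L))) ⟩
  harmonic (2 ℕ.^ L) + ℕtoℚ (2 ℕ.^ L) * inv (2 ℕ.^ suc L)
    ≤⟨ harmonic-block (2 ℕ.^ L) (2 ℕ.^ L) (ℕₚ.≤-reflexive (cong (2 ℕ.^ L ℕ.+_) (sym (ℕₚ.+-identityʳ (2 ℕ.^ L))))) ⟩
  harmonic (2 ℕ.^ L ℕ.+ 2 ℕ.^ L)               ≡⟨ cong (λ k → harmonic (2 ℕ.^ L ℕ.+ k)) (sym (ℕₚ.+-identityʳ (2 ℕ.^ L))) ⟩
  harmonic (2 ℕ.^ suc L) ∎
  where
  open ≤-Reasoning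
  lem : ∀ x → (1ℚ + x) * (ℤ.+ 1 / 2) ≡ x * (ℤ.+ 1 / 2) + (ℤ.+ 1 / 2)
  lem = solve-∀ ℚ-ring
  lem′ : ∀ x y → x * ((ℤ.+ 1 / 2) * y) ≡ (x * y) * (ℤ.+ 1 / 2)
  lem′ = solve-∀ ℚ-ring
  half : ℕtoℚ (2 ℕ.^ L) * (inv 2 * inv (2 ℕ.^ L)) ≡ inv 2
  half = trans (lem′ (ℕtoℚ (2 ℕ.^ L)) (inv (2 ℕ.^ L)))
    (trans (cong (_* inv 2) (ℕtoℚ*inv (2 ℕ.^ L) {{ℕₚ.m^n≢0 2 L}})) (*-identityˡ (inv 2)))

log≤2totalN : ∀ n .{{_ : NonZero n}} → ℕtoℚ ⌊log₂ n ⌋ ≤ ℕtoℚ 2 * totalN n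
log≤2totalN n = begin
  ℕtoℚ L                             ≡⟨ lem (ℕtoℚ L) ⟩
  ℕtoℚ 2 * (ℕtoℚ L * inv 2)          ≤⟨ *-monoˡ (0≤ℕtoℚ 2) (≤-trans (half-log≤harmonic L) (harmonic-mono (2^⌊log₂n⌋≤n n))) ⟩
  ℕtoℚ 2 * harmonic n                ≡⟨ cong (ℕtoℚ 2 *_) (sym (totalN≡harmonic n)) ⟩
  ℕtoℚ 2 * totalN n ∎
  where
  open ≤-Reasoning
  L = ⌊log₂ n ⌋
  lem : ∀ x → x ≡ (ℤ.+ 2 / 1) * (x * (ℤ.+ 1 / 2))
  lem = solve-∀ ℚ-ring

-- Loss of the algorithm

if-does : {P : Set} {A : Set} (P? : Dec P) {x y : A} (Q : A → Set) →
  (P → Q x) → (¬ P → Q y) → Q (if does P? then x else y)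
if-does (yes p) Q q₁ q₂ = q₁ p
if-does (no ¬p) Q q₁ q₂ = q₂ ¬p

∣p-q∣≡∣q-p∣ : ∀ p q → ∣ p - q ∣ ≡ ∣ q - p ∣
∣p-q∣≡∣q-p∣ p q = trans (sym (∣-p∣≡∣p∣ (p - q))) (cong ∣_∣ (lem p q))
  where
  lem : ∀ p q → - (p - q) ≡ q - p
  lem = solve-∀ ℚ-ring

module _ (n B m w₁ w₂ : ℕ) .{{_ : NonZero B}} .{{_ : NonZero w₁}} .{{_ : NonZero w₂}} (τ κ : ℚ)
  (3≤m : 3 ℕ.≤ m) (τ≥0 : 0ℚ ≤ τ) (κ≥0 : 0ℚ ≤ κ)
  -- The scale `κ` is under two opposite constraints: small enough that 1/4 + κe has mean at most
  -- 1/2, and large enough that an error of τ - 1/B raises it to 4. A large constant in `τ`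
  -- reconciles them.
  (κδ≤¼ : κ * (ℕtoℚ 54 * inv w₁) ≤ inv 4)
  (gap : ℤ.+ 15 / 4 ≤ κ * (τ - inv B)) where

  private
    f : Fin n → ℚ
    f = zipf n
    f≥0 : ∀ i → 0ℚ ≤ f i
    f≥0 = zipf≥0 n
    δ₁ δ₂ M u ε : ℚ
    δ₁ = ℕtoℚ 54 * inv w₁
    δ₂ = ℕtoℚ 54 * inv w₂
    M = ℕtoℚ m
    u = τ + δ₁
    ε = inv (2 ℕ.^ m)

    Ss-list : List (Vec (Table n w₁) m)
    Ss-list = allVec m (allTables n w₁)

    E₁ : (Table n w₁ → ℚ) → ℚ
    E₁ = Ex (allTables n w₁)
    E₂ : (Table n w₂ → ℚ) → ℚ
    E₂ = Ex (allTables n w₂)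
    Es : (Vec (Table n w₁) m → ℚ) → ℚ
    Es = Ex Ss-list

    δ₂≥0 : 0ℚ ≤ δ₂
    δ₂≥0 = *-nonneg (0≤ℕtoℚ 54) (0≤inv w₂)
    δ₁≥0 : 0ℚ ≤ δ₁
    δ₁≥0 = *-nonneg (0≤ℕtoℚ 54) (0≤inv w₁)
    u≥0 : 0ℚ ≤ u
    u≥0 = +-nonneg τ≥0 δ₁≥0

    err₁ : ∀ i → E₁ (tableErr f i) ≤ δ₁
    err₁ i = Ex-tableErr f f≥0 i (zipf-tail² n w₁ i) (zipf-head⊓ n w₁ i)
    err₂ : ∀ i → E₂ (tableErr f i) ≤ δ₂
    err₂ i = Ex-tableErr f f≥0 i (zipf-tail² n w₂ i) (zipf-head⊓ n w₂ i)

    pairTerm : Fin n → Table n w₁ → Table n w₁ → ℚ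
    pairTerm i S S′ = (τ + tableErr f i S) * (τ + tableErr f i S′)

    u-term≥0 : ∀ i (S : Table n w₁) → 0ℚ ≤ τ + tableErr f i S
    u-term≥0 i S = +-nonneg τ≥0 (0≤∣p∣ (csEst f S i - f i))

    prodTerm : Fin n → Table n w₁ → ℚ
    prodTerm i S = inv 4 + κ * tableErr f i S

    prodTerm≥¼ : ∀ i S → inv 4 ≤ prodTerm i S
    prodTerm≥¼ i S = p≤p+q (*-nonneg κ≥0 (0≤∣p∣ (csEst f S i - f i)))

    -- The expectation of the product splits over two independent tables, so the mean error of one
    -- table suffices.
    Es-pairs : ∀ i → Es (pairSum (pairTerm i)) ≤ M * M * (u * u)
    Es-pairs i = Ex-pairSum (pairTerm i) (λ S S′ → *-nonneg (u-term≥0 i S) (u-term≥0 i S′)) (allTables n w₁) m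
      (begin
        E₁ (λ S → E₁ (pairTerm i S))
          ≡⟨ Ex-cong (allTables n w₁) (λ S → Ex-*ˡ (allTables n w₁) (τ + tableErr f i S) _) ⟩
        E₁ (λ S → (τ + tableErr f i S) * E₁ (λ S′ → τ + tableErr f i S′))
          ≡⟨ Ex-*ʳ (allTables n w₁) _ (λ S → τ + tableErr f i S) ⟩
        E₁ (λ S → τ + tableErr f i S) * E₁ (λ S′ → τ + tableErr f i S′)
          ≤⟨ *-mono (Ex-nonneg (allTables n w₁) (u-term≥0 i)) u≥0 single single ⟩
        u * u ∎)
      where
      open ≤-Reasoning
      single : E₁ (λ S → τ + tableErr f i S) ≤ u
      single = ≤-trans (≤-reflexive (Ex-+ (allTables n w₁) (λ _ → τ) (tableErr f i)))
        (+-mono-≤ (Ex-const≤ (allTables n w₁) τ≥0) (err₁ i))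

    Es-product : ∀ i → Es (productOver (prodTerm i)) ≤ ε
    Es-product i = Ex-productOver (prodTerm i) (prodTerm≥¼ i) (allTables n w₁) m (begin
      E₁ (prodTerm i)
        ≡⟨ trans (Ex-+ (allTables n w₁) (λ _ → inv 4) _) (cong (E₁ (λ _ → inv 4) +_) (Ex-*ˡ (allTables n w₁) κ (tableErr f i))) ⟩
      E₁ (λ _ → inv 4) + κ * E₁ (tableErr f i)
        ≤⟨ +-mono-≤ (Ex-const≤ (allTables n w₁) 0≤¼) (≤-trans (*-monoˡ κ≥0 (err₁ i)) κδ≤¼) ⟩
      inv 4 + inv 4
        ≡⟨⟩
      inv 2 ∎)
      where open ≤-Reasoning

    loss : Fin n → Vec (Table n w₁) m → Table n w₂ → ℚ
    loss i Ss S = f i * ∣ f i - algOut n m w₁ w₂ τ Ss S i ∣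

    zero-loss : ∀ i → f i * ∣ f i - 0ℚ ∣ ≡ f i * f i
    zero-loss i = cong (f i *_) (trans (cong ∣_∣ (lem (f i))) (0≤p⇒∣p∣≡p (f≥0 i)))
      where
      lem : ∀ x → x - 0ℚ ≡ x
      lem = solve-∀ ℚ-ring

    kept-loss : ∀ i (S : Table n w₂) → f i * ∣ f i - csEst f S i ∣ ≡ f i * tableErr f i S
    kept-loss i S = cong (f i *_) (∣p-q∣≡∣q-p∣ (f i) (csEst f S i))

    fe≥0 : ∀ i (S : Table n w₂) → 0ℚ ≤ f i * tableErr f i S
    fe≥0 i S = *-nonneg (f≥0 i) (0≤∣p∣ (csEst f S i - f i))

    pairSum≥0 : ∀ i (Ss : Vec (Table n w₁) m) → 0ℚ ≤ pairSum (pairTerm i) Ss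
    pairSum≥0 i Ss = pairSum-nonneg (pairTerm i) (λ S S′ → *-nonneg (u-term≥0 i S) (u-term≥0 i S′)) Ss

    product≥0 : ∀ i (Ss : Vec (Table n w₁) m) → 0ℚ ≤ productOver (prodTerm i) Ss
    product≥0 i Ss = productOver-nonneg (prodTerm i) (prodTerm≥¼ i) Ss

    E-fe : ∀ i → E₂ (λ S → f i * tableErr f i S) ≤ f i * δ₂
    E-fe i = ≤-trans (≤-reflexive (Ex-*ˡ (allTables n w₂) (f i) (tableErr f i))) (*-monoˡ (f≥0 i) (err₂ i))

    -- Zeroing costs f_i² and keeping costs f_i times the error of the last table. Both bounds are
    -- nonnegative and simply added, which avoids conditioning on the test.
    head-loss : ∀ i → Es (λ Ss → E₂ (loss i Ss)) ≤ M * M * (u * u) + f i * δ₂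
    head-loss i = begin
      Es (λ Ss → E₂ (loss i Ss))
        ≤⟨ Ex-mono Ss-list (λ Ss → ≤-trans (Ex-mono (allTables n w₂) (pointwise Ss))
             (≤-trans (≤-reflexive (Ex-+ (allTables n w₂) (λ _ → pairSum (pairTerm i) Ss) _))
               (+-mono-≤ (Ex-const≤ (allTables n w₂) (pairSum≥0 i Ss)) (E-fe i)))) ⟩
      Es (λ Ss → pairSum (pairTerm i) Ss + f i * δ₂)
        ≡⟨ Ex-+ Ss-list (pairSum (pairTerm i)) (λ _ → f i * δ₂) ⟩
      Es (pairSum (pairTerm i)) + Es (λ _ → f i * δ₂)
        ≤⟨ +-mono-≤ (Es-pairs i) (Ex-const≤ Ss-list (*-nonneg (f≥0 i) δ₂≥0)) ⟩
      M * M * (u * u) + f i * δ₂ ∎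
      where
      open ≤-Reasoning
      pointwise : ∀ Ss S → loss i Ss S ≤ pairSum (pairTerm i) Ss + f i * tableErr f i S
      pointwise Ss S = if-does (_ <? τ) (λ x → f i * ∣ f i - x ∣ ≤ pairSum (pairTerm i) Ss + f i * tableErr f i S)
        (λ med<τ → ≤-trans (≤-reflexive (zero-loss i))
          (≤-trans (median<τ (λ S′ → csEst f S′ i) (f i) τ (f≥0 i) τ≥0 3≤m Ss med<τ) (p≤p+q (fe≥0 i S))))
        (λ _ → ≤-trans (≤-reflexive (kept-loss i S)) (p≤q+p (pairSum≥0 i Ss)))

    -- If the item is kept, the product over the small tables is at least 1 and may multiply the
    -- loss. The last table is independent of it, so the expectations separate into `ε` and f_i δ₂.
    tail-loss : ∀ i → f i ≤ inv B → Es (λ Ss → E₂ (loss i Ss)) ≤ f i * f i + ε * (f i * δ₂)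
    tail-loss i f≤ = begin
      Es (λ Ss → E₂ (loss i Ss))
        ≤⟨ Ex-mono Ss-list (λ Ss → ≤-trans (Ex-mono (allTables n w₂) (pointwise Ss))
             (≤-trans (≤-reflexive (trans (Ex-+ (allTables n w₂) (λ _ → f i * f i) _)
                 (cong (E₂ (λ _ → f i * f i) +_) (Ex-*ˡ (allTables n w₂) (productOver (prodTerm i) Ss) _))))
               (+-mono-≤ (Ex-const≤ (allTables n w₂) (sq-nonneg (f i))) (*-monoˡ (product≥0 i Ss) (E-fe i))))) ⟩
      Es (λ Ss → f i * f i + productOver (prodTerm i) Ss * (f i * δ₂))
        ≡⟨ trans (Ex-+ Ss-list (λ _ → f i * f i) _) (cong (Es (λ _ → f i * f i) +_) (Ex-*ʳ Ss-list (f i * δ₂) (productOver (prodTerm i)))) ⟩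
      Es (λ _ → f i * f i) + Es (productOver (prodTerm i)) * (f i * δ₂)
        ≤⟨ +-mono-≤ (Ex-const≤ Ss-list (sq-nonneg (f i))) (*-monoʳ (*-nonneg (f≥0 i) δ₂≥0) (Es-product i)) ⟩
      f i * f i + ε * (f i * δ₂) ∎
      where
      open ≤-Reasoning
      gap-i : ℤ.+ 15 / 4 ≤ κ * (τ - f i)
      gap-i = ≤-trans gap (*-monoˡ κ≥0 (+-monoʳ-≤ τ (neg-antimono-≤ f≤)))
      pointwise : ∀ Ss S → loss i Ss S ≤ f i * f i + productOver (prodTerm i) Ss * (f i * tableErr f i S)
      pointwise Ss S = if-does (_ <? τ)
        (λ x → f i * ∣ f i - x ∣ ≤ f i * f i + productOver (prodTerm i) Ss * (f i * tableErr f i S))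
        (λ _ → ≤-trans (≤-reflexive (zero-loss i)) (p≤p+q (*-nonneg (product≥0 i Ss) (fe≥0 i S))))
        (λ med≮τ → ≤-trans (≤-reflexive (trans (kept-loss i S) (sym (*-identityˡ _))))
          (≤-trans (*-monoʳ (fe≥0 i S)
              (median≥τ (λ S′ → csEst f S′ i) (f i) τ κ κ≥0 gap-i Ss (≮⇒≥ med≮τ)))
            (p≤q+p (sq-nonneg (f i)))))

    below : Fin n → Bool
    below i = toℕ i ℕ.<ᵇ B

    fHead fTail lossBound : Fin n → ℚ
    fHead i = if below i then f i else 0ℚ
    fTail i = if below i then 0ℚ else f i
    -- The `ε` term is charged to every item, also below B, so that it sums to a multiple of the
    -- whole of `totalN n`.
    lossBound i = (M * M * (u * u) * 𝟙 (below i) + δ₂ * fHead i) + (fTail i * fTail i + ε * δ₂ * f i)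

    item-loss : ∀ i → Es (λ Ss → E₂ (loss i Ss)) ≤ lossBound i
    item-loss i with toℕ i ℕ.<ᵇ B in eq
    ... | true = ≤-trans (head-loss i) (≤-by (*-nonneg (*-nonneg (0≤inv (2 ℕ.^ m)) δ₂≥0) (f≥0 i)) (lem (M * M * (u * u)) (f i) δ₂ ε))
      where
      lem : ∀ r x d e → (r * 1ℚ + d * x) + (0ℚ * 0ℚ + e * d * x) ≡ r + x * d + e * d * x
      lem = solve-∀ ℚ-ring
    -- An index of at least B, counted from 0, is a rank of at least B + 1, whence f_i ≤ 1/B.
    ... | false = ≤-trans (tail-loss i (inv-antitone {B} {suc (toℕ i)} (ℕₚ.m≤n⇒m≤1+n (ℕₚ.≮⇒≥ (λ i<B → subst T eq (ℕₚ.<⇒<ᵇ i<B))))))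
        (≤-reflexive (lem (M * M * (u * u)) (f i) δ₂ ε))
      where
      lem : ∀ r x d e → x * x + e * (x * d) ≡ (r * 0ℚ + d * 0ℚ) + (x * x + e * d * x)
      lem = solve-∀ ℚ-ring

  expected-loss :
    Ex (allVec m (allTables n w₁)) (λ Ss → Ex (allTables n w₂) (λ S →
      sumFin n (λ i → zipf n i * ∣ zipf n i - algOut n m w₁ w₂ τ Ss S i ∣)))
    ≤ (M * M * (u * u) * ℕtoℚ B + δ₂ * harmonic B) + (inv B + ε * δ₂ * totalN n)
  expected-loss = begin
    Es (λ Ss → E₂ (λ S → sumFin n (λ i → loss i Ss S)))
      ≡⟨ trans (Ex-cong Ss-list (λ Ss → Ex-sumFin (allTables n w₂) n (λ i → loss i Ss))) (Ex-sumFin Ss-list n (λ i Ss → E₂ (loss i Ss))) ⟩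
    sumFin n (λ i → Es (λ Ss → E₂ (loss i Ss)))
      ≤⟨ sumFin-mono n item-loss ⟩
    sumFin n lossBound
      ≡⟨ trans (sumFin-+ n _ _) (cong₂ _+_
           (trans (sumFin-+ n _ _) (cong₂ _+_ (sumFin-*ˡ n (M * M * (u * u)) (𝟙 ∘ below)) (sumFin-*ˡ n δ₂ fHead)))
           (trans (sumFin-+ n _ _) (cong (sumFin n (λ i → fTail i * fTail i) +_) (sumFin-*ˡ n (ε * δ₂) f)))) ⟩
    (M * M * (u * u) * sumFin n (𝟙 ∘ below) + δ₂ * sumFin n fHead) +
      (sumFin n (λ i → fTail i * fTail i) + ε * δ₂ * totalN n)
      ≤⟨ +-mono-≤
           (+-mono-≤ (*-monoˡ (*-nonneg (*-nonneg (0≤ℕtoℚ m) (0≤ℕtoℚ m)) (*-nonneg u≥0 u≥0)) (sum-𝟙< n B))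
                     (*-monoˡ δ₂≥0 (zipf-upto n B)))
           (+-monoˡ-≤ (ε * δ₂ * totalN n) (zipf-beyond n B)) ⟩
    (M * M * (u * u) * ℕtoℚ B + δ₂ * harmonic B) + (inv B + ε * δ₂ * totalN n) ∎
    where open ≤-Reasoning

-- Choice of parameters and the final bound

m≤2[m/d]d : ∀ m d .{{_ : NonZero d}} → d ℕ.≤ m → m ℕ.≤ (m ℕ./ d) ℕ.* (2 ℕ.* d)
m≤2[m/d]d m d d≤m = begin
  m                                        ≡⟨ DivMod.m≡m%n+[m/n]*n m d ⟩
  m ℕ.% d ℕ.+ q ℕ.* d                      ≤⟨ ℕₚ.+-monoˡ-≤ (q ℕ.* d) (ℕₚ.<⇒≤ (DivMod.m%n<n m d)) ⟩
  -- Rounding down loses at most a factor 2, because the quotient is at least 1 and the lost part is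
  -- less than `d`.
  d ℕ.+ q ℕ.* d                            ≤⟨ ℕₚ.+-monoˡ-≤ (q ℕ.* d) (ℕₚ.m≤n*m d q {{q≢0}}) ⟩
  q ℕ.* d ℕ.+ q ℕ.* d                      ≡⟨ sym (ℕₚ.*-distribˡ-+ q d d) ⟩
  q ℕ.* (d ℕ.+ d)                          ≡⟨ cong (λ x → q ℕ.* (d ℕ.+ x)) (sym (ℕₚ.+-identityʳ d)) ⟩
  q ℕ.* (2 ℕ.* d) ∎
  where
  open ℕₚ.≤-Reasoning
  q = m ℕ./ d
  q≢0 : NonZero q
  q≢0 = ℕ.>-nonZero (DivMod.m≥n⇒m/n>0 d≤m)

6[1+ℓ]≤2^ℓ : ∀ {ℓ} → 6 ℕ.≤ ℓ → 6 ℕ.* suc ℓ ℕ.≤ 2 ^ ℓ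
6[1+ℓ]≤2^ℓ {ℓ} 6≤ℓ = subst (λ k → 6 ℕ.* suc k ℕ.≤ 2 ^ k) (ℕₚ.m∸n+n≡m 6≤ℓ) (go (ℓ ℕ.∸ 6))
  where
  open ℕₚ.≤-Reasoning
  go : ∀ d → 6 ℕ.* suc (d ℕ.+ 6) ℕ.≤ 2 ^ (d ℕ.+ 6)
  go zero = toWitness {a? = 42 ℕₚ.≤? 64} _
  go (suc d) = begin
    6 ℕ.* suc (suc (d ℕ.+ 6))                       ≡⟨ ℕₚ.*-suc 6 (suc (d ℕ.+ 6)) ⟩
    6 ℕ.+ 6 ℕ.* suc (d ℕ.+ 6)                       ≤⟨ ℕₚ.+-monoˡ-≤ _ (ℕₚ.m≤m*n 6 (suc (d ℕ.+ 6))) ⟩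
    6 ℕ.* suc (d ℕ.+ 6) ℕ.+ 6 ℕ.* suc (d ℕ.+ 6)     ≤⟨ ℕₚ.+-mono-≤ (go d) (go d) ⟩
    2 ^ (d ℕ.+ 6) ℕ.+ 2 ^ (d ℕ.+ 6)                 ≡⟨ cong (2 ^ (d ℕ.+ 6) ℕ.+_) (sym (ℕₚ.+-identityʳ _)) ⟩
    2 ^ suc (d ℕ.+ 6) ∎

2^k≤n⇒k≤⌊log₂n⌋ : ∀ k {n} → 2 ^ k ℕ.≤ n → k ℕ.≤ ⌊log₂ n ⌋
2^k≤n⇒k≤⌊log₂n⌋ k 2^k≤n = ℕₚ.≤-trans (ℕₚ.≤-reflexive (sym (⌊log₂[2^n]⌋≡n k))) (⌊log₂⌋-mono-≤ 2^k≤n)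

1/≡inv : ∀ B .{{_ : NonZero B}} → ℤ.+ 1 / B ≡ inv B
1/≡inv (suc B) = refl

module Bound (n B : ℕ) (n≥2^64 : 2 ^ 64 ℕ.≤ n) (B≥log : ⌈log₂ n ⌉ ℕ.≤ B) .{{B≢0 : NonZero B}} where

  n≢0 : NonZero n
  n≢0 = ℕ.>-nonZero (ℕₚ.≤-trans (ℕₚ.m^n>0 2 64) n≥2^64)

  L ℓ m w₁ w₂ : ℕ
  L = ⌊log₂ n ⌋
  ℓ = lglg n
  m = numT 1 n ℕ.∸ 1
  w₁ = width₁ 1 n B
  w₂ = width₂ B

  m≡ℓ : m ≡ ℓ
  m≡ℓ = ℕₚ.+-identityʳ ℓ

  64≤L : 64 ℕ.≤ L
  64≤L = 2^k≤n⇒k≤⌊log₂n⌋ 64 n≥2^64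

  -- ℓ ≥ 6 is what makes 6(1+ℓ) ≤ 2^ℓ, so that both widths are positive; hence n₀ = 2^64.
  6≤ℓ : 6 ℕ.≤ ℓ
  6≤ℓ = 2^k≤n⇒k≤⌊log₂n⌋ 6 64≤L

  3≤m : 3 ℕ.≤ m
  3≤m = ℕₚ.≤-trans (ℕₚ.≤-trans (s≤s (s≤s (s≤s z≤n))) 6≤ℓ) (ℕₚ.≤-reflexive (sym m≡ℓ))

  1≤ℓ : 1 ℕ.≤ ℓ
  1≤ℓ = ℕₚ.≤-trans (s≤s z≤n) 6≤ℓ

  L≢0 : NonZero L
  L≢0 = ℕ.>-nonZero (ℕₚ.≤-trans (s≤s z≤n) 64≤L)

  L≤B : L ℕ.≤ B
  L≤B = ℕₚ.≤-trans (ℕₚ.≤-reflexive (sym (⌈log₂2^n⌉≡n L)))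
    (ℕₚ.≤-trans (⌈log₂⌉-mono-≤ (2^⌊log₂n⌋≤n n {{n≢0}})) B≥log)

  -- The assumption that B is at least log n enters here, through 6(1+ℓ) ≤ 2^ℓ ≤ log n ≤ B; it keeps
  -- the floors in both widths from being 0.
  6[1+ℓ]≤B : 6 ℕ.* suc ℓ ℕ.≤ B
  6[1+ℓ]≤B = ℕₚ.≤-trans (6[1+ℓ]≤2^ℓ 6≤ℓ) (ℕₚ.≤-trans (2^⌊log₂n⌋≤n L {{L≢0}}) L≤B)

  d≤B : 6 ℕ.* numT 1 n ℕ.≤ B
  d≤B = ℕₚ.≤-trans (ℕₚ.≤-reflexive (cong (λ k → 6 ℕ.* suc k) m≡ℓ)) 6[1+ℓ]≤B

  6≤B : 6 ℕ.≤ B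
  6≤B = ℕₚ.≤-trans (ℕₚ.m≤m*n 6 (suc ℓ)) 6[1+ℓ]≤B

  w₁≢0 : NonZero w₁
  w₁≢0 = ℕ.>-nonZero (DivMod.m≥n⇒m/n>0 d≤B)

  w₂≢0 : NonZero w₂
  w₂≢0 = ℕ.>-nonZero (DivMod.m≥n⇒m/n>0 6≤B)

  -- 24 = 2 · 6 · 2: the factors come from rounding down, from the division by 6T, and from 1 + ℓ ≤
  -- 2ℓ.
  B≤24ℓw₁ : B ℕ.≤ w₁ ℕ.* (24 ℕ.* ℓ)
  B≤24ℓw₁ = ℕₚ.≤-trans (m≤2[m/d]d B (6 ℕ.* numT 1 n) d≤B) (ℕₚ.*-monoʳ-≤ w₁ (begin
    2 ℕ.* (6 ℕ.* suc m)      ≡⟨ sym (ℕₚ.*-assoc 2 6 (suc m)) ⟩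
    12 ℕ.* suc m             ≡⟨ cong (λ k → 12 ℕ.* suc k) m≡ℓ ⟩
    12 ℕ.* suc ℓ             ≤⟨ ℕₚ.*-monoʳ-≤ 12 (ℕₚ.+-monoˡ-≤ ℓ 1≤ℓ) ⟩
    12 ℕ.* (ℓ ℕ.+ ℓ)         ≡⟨ cong (λ k → 12 ℕ.* (ℓ ℕ.+ k)) (sym (ℕₚ.+-identityʳ ℓ)) ⟩
    12 ℕ.* (2 ℕ.* ℓ)         ≡⟨ sym (ℕₚ.*-assoc 12 2 ℓ) ⟩
    24 ℕ.* ℓ ∎))
    where open ℕₚ.≤-Reasoning

  cτ b λ′ β τ κ N F lb ε u₀ C₀ : ℚ
  cτ = ℕtoℚ 19441
  b = ℕtoℚ B
  λ′ = ℕtoℚ ℓ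
  β = inv B
  τ = tau cτ n B
  -- 216 = 4 · 54 makes κ · 54/w₁ exactly 1/4.
  κ = ℕtoℚ w₁ * inv 216
  N = totalN n
  F = ℕtoℚ L
  lb = ℕtoℚ ⌊log₂ B ⌋
  ε = inv (2 ^ m)
  -- 1296 = 54 · 24 bounds the mean error of a small table in units of ℓ/B, and 648 = 54 · 12 that
  -- of the last table in units of 1/B. Then 2594 = 2 · (648 + 1) + 2 · 648 collects the constants
  -- that remain in `bound`.
  u₀ = cτ + ℕtoℚ 1296
  C₀ = ℕtoℚ 2 * (u₀ * u₀) + ℕtoℚ 2594

  bβ≡1 : b * β ≡ 1ℚ
  bβ≡1 = ℕtoℚ*inv B

  λ≥1 : 1ℚ ≤ λ′
  λ≥1 = ℕtoℚ-mono 1≤ℓ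

  λ≥0 : 0ℚ ≤ λ′
  λ≥0 = 0≤ℕtoℚ ℓ

  N≥0 : 0ℚ ≤ N
  N≥0 = sumFin-nonneg n (zipf≥0 n)

  τ≡ : τ ≡ cτ * λ′ * β
  τ≡ = cong (cτ * λ′ *_) (1/≡inv B)

  τ≥0 : 0ℚ ≤ τ
  τ≥0 = ≤-trans (*-nonneg (*-nonneg (0≤ℕtoℚ 19441) λ≥0) (0≤inv B)) (≤-reflexive (sym τ≡))

  κ≥0 : 0ℚ ≤ κ
  κ≥0 = *-nonneg (0≤ℕtoℚ w₁) (0≤inv 216)

  κδ≤¼ : κ * (ℕtoℚ 54 * inv w₁) ≤ inv 4
  κδ≤¼ = ≤-reflexive (trans (lem (ℕtoℚ w₁) (inv w₁)) (cong (_* inv 4) (ℕtoℚ*inv w₁ {{w₁≢0}})))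
    where
    lem : ∀ x y → x * (ℤ.+ 1 / 216) * ((ℤ.+ 54 / 1) * y) ≡ (x * y) * (ℤ.+ 1 / 4)
    lem = solve-∀ ℚ-ring

  -- cτ = 216 · 90 + 1 leaves κ (τ - β) ≥ 90 w₁ ℓ / B, which is at least 90/24 as B ≤ 24 ℓ w₁.
  gap : ℤ.+ 15 / 4 ≤ κ * (τ - β)
  gap = begin
    1ℚ * (ℤ.+ 15 / 4)
      ≡⟨ cong (_* (ℤ.+ 15 / 4)) (sym bβ≡1) ⟩
    b * β * (ℤ.+ 15 / 4)
      ≤⟨ *-monoʳ (nonNegative⁻¹ (ℤ.+ 15 / 4)) (*-monoʳ (0≤inv B) (≤-trans (ℕtoℚ-mono B≤24ℓw₁)
           (≤-reflexive (trans (ℕtoℚ-* w₁ (24 ℕ.* ℓ)) (cong (ℕtoℚ w₁ *_) (ℕtoℚ-* 24 ℓ)))))) ⟩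
    ℕtoℚ w₁ * (ℕtoℚ 24 * λ′) * β * (ℤ.+ 15 / 4)
      ≤⟨ ≤-by (*-nonneg (*-nonneg κ≥0 (0≤q-p λ≥1)) (0≤inv B)) (lem (ℕtoℚ w₁) λ′ β) ⟩
    κ * (cτ * λ′ * β - β)
      ≡⟨ cong (λ x → κ * (x - β)) (sym τ≡) ⟩
    κ * (τ - β) ∎
    where
    open ≤-Reasoning
    lem : ∀ w l β → w * (ℤ.+ 1 / 216) * ((ℤ.+ 19441 / 1) * l * β - β) ≡
      w * ((ℤ.+ 24 / 1) * l) * β * (ℤ.+ 15 / 4) + w * (ℤ.+ 1 / 216) * (l - 1ℚ) * β
    lem = solve-∀ ℚ-ring

  u≤ : τ + ℕtoℚ 54 * inv w₁ ≤ u₀ * λ′ * β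
  u≤ = begin
    τ + ℕtoℚ 54 * inv w₁
      ≤⟨ +-mono-≤ (≤-reflexive τ≡) (*-monoˡ (0≤ℕtoℚ 54) (inv-scale (24 ℕ.* ℓ) {{w₁≢0}} B≤24ℓw₁)) ⟩
    cτ * λ′ * β + ℕtoℚ 54 * (ℕtoℚ (24 ℕ.* ℓ) * β)
      ≡⟨ cong (λ x → cτ * λ′ * β + ℕtoℚ 54 * (x * β)) (ℕtoℚ-* 24 ℓ) ⟩
    cτ * λ′ * β + ℕtoℚ 54 * (ℕtoℚ 24 * λ′ * β)
      ≡⟨ lem cτ λ′ β ⟩
    u₀ * λ′ * β ∎
    where
    open ≤-Reasoning
    lem : ∀ c l β → c * l * β + (ℤ.+ 54 / 1) * ((ℤ.+ 24 / 1) * l * β) ≡ (c + (ℤ.+ 1296 / 1)) * l * β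
    lem = solve-∀ ℚ-ring

  δ₂≤ : ℕtoℚ 54 * inv w₂ ≤ ℕtoℚ 648 * β
  δ₂≤ = ≤-trans (*-monoˡ (0≤ℕtoℚ 54) (inv-scale 12 {{w₂≢0}} (m≤2[m/d]d B 6 6≤B))) (≤-reflexive (lem β))
    where
    lem : ∀ β → (ℤ.+ 54 / 1) * ((ℤ.+ 12 / 1) * β) ≡ (ℤ.+ 648 / 1) * β
    lem = solve-∀ ℚ-ring

  -- There are exactly ℓ small tables and log n < 2^(ℓ+1), so the failure bound 2^-ℓ cancels log n.
  -- This is why the constant 1 in T is enough.
  Fε≤2 : F * ε ≤ ℕtoℚ 2
  Fε≤2 = begin
    F * ε
      ≡⟨ cong (λ k → F * inv (2 ^ k)) m≡ℓ ⟩
    F * inv (2 ^ ℓ)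
      ≤⟨ *-monoʳ (0≤inv (2 ^ ℓ)) (ℕtoℚ-mono (ℕₚ.<⇒≤ (n<2^[1+⌊log₂n⌋] L))) ⟩
    ℕtoℚ (2 ^ suc ℓ) * inv (2 ^ ℓ)
      ≡⟨ trans (cong (_* inv (2 ^ ℓ)) (ℕtoℚ-* 2 (2 ^ ℓ))) (*-assoc (ℕtoℚ 2) (ℕtoℚ (2 ^ ℓ)) (inv (2 ^ ℓ))) ⟩
    ℕtoℚ 2 * (ℕtoℚ (2 ^ ℓ) * inv (2 ^ ℓ))
      ≡⟨ cong (ℕtoℚ 2 *_) (ℕtoℚ*inv (2 ^ ℓ) {{ℕₚ.m^n≢0 2 ℓ}}) ⟩
    ℕtoℚ 2 ∎
    where open ≤-Reasoning

  λ⁴ : ℚ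
  λ⁴ = ℕtoℚ (ℓ ^ 4)

  λ⁴≡ : λ⁴ ≡ λ′ * (λ′ * (λ′ * (λ′ * 1ℚ)))
  λ⁴≡ = trans (ℕtoℚ-* ℓ (ℓ ^ 3)) (cong (λ′ *_) (trans (ℕtoℚ-* ℓ (ℓ ^ 2)) (cong (λ′ *_)
    (trans (ℕtoℚ-* ℓ (ℓ ^ 1)) (cong (λ′ *_) (ℕtoℚ-* ℓ 1))))))

  λ⁴≥1 : 1ℚ ≤ λ⁴
  λ⁴≥1 = ℕtoℚ-mono (ℕₚ.m^n>0 ℓ {{ℕ.>-nonZero 1≤ℓ}} 4)

  ε≥0 : 0ℚ ≤ ε
  ε≥0 = 0≤inv (2 ^ m)

  R : ℚ
  R = u₀ * u₀ * λ⁴ + ℕtoℚ 648 * (1ℚ + lb) + 1ℚ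

  loss≤ : expWeightedErr 1 cτ n B ≤ (R + ℕtoℚ 648 * ε * N) * β
  loss≤ = begin
    expWeightedErr 1 cτ n B
      ≤⟨ expected-loss n B m w₁ w₂ {{B≢0}} {{w₁≢0}} {{w₂≢0}} τ κ 3≤m τ≥0 κ≥0 κδ≤¼ gap ⟩
    (ℕtoℚ m * ℕtoℚ m * (u * u) * b + δ₂ * harmonic B) + (β + ε * δ₂ * N)
      ≡⟨ cong (λ k → (ℕtoℚ k * ℕtoℚ k * (u * u) * b + δ₂ * harmonic B) + (β + ε * δ₂ * N)) m≡ℓ ⟩
    (λ′ * λ′ * (u * u) * b + δ₂ * harmonic B) + (β + ε * δ₂ * N)
      ≤⟨ +-mono-≤
           (+-mono-≤ (*-monoʳ (0≤ℕtoℚ B) (*-monoˡ (*-nonneg λ≥0 λ≥0) (*-mono u≥0 u₀λβ≥0 u≤ u≤)))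
             (≤-trans (*-monoʳ H≥0 δ₂≤) (*-monoˡ 648β≥0 (harmonic≤1+log B))))
           (+-monoʳ-≤ β (*-monoʳ N≥0 (*-monoˡ ε≥0 δ₂≤))) ⟩
    (λ′ * λ′ * (u₀ * λ′ * β * (u₀ * λ′ * β)) * b + ℕtoℚ 648 * β * (1ℚ + lb)) + (β + ε * (ℕtoℚ 648 * β) * N)
      ≡⟨ lem λ′ u₀ β b lb ε N ⟩
    (u₀ * u₀ * (λ′ * (λ′ * (λ′ * (λ′ * 1ℚ)))) * (b * β) + ℕtoℚ 648 * (1ℚ + lb) + 1ℚ + ℕtoℚ 648 * ε * N) * β
      ≡⟨ cong (λ x → (x + ℕtoℚ 648 * (1ℚ + lb) + 1ℚ + ℕtoℚ 648 * ε * N) * β)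
           (trans (cong₂ (λ x y → u₀ * u₀ * x * y) (sym λ⁴≡) bβ≡1) (*-identityʳ (u₀ * u₀ * λ⁴))) ⟩
    (R + ℕtoℚ 648 * ε * N) * β ∎
    where
    open ≤-Reasoning
    u δ₂ : ℚ
    u = τ + ℕtoℚ 54 * inv w₁
    δ₂ = ℕtoℚ 54 * inv w₂
    u≥0 : 0ℚ ≤ u
    u≥0 = +-nonneg τ≥0 (*-nonneg (0≤ℕtoℚ 54) (0≤inv w₁))
    u₀λβ≥0 : 0ℚ ≤ u₀ * λ′ * β
    u₀λβ≥0 = ≤-trans u≥0 u≤
    H≥0 : 0ℚ ≤ harmonic B
    H≥0 = harmonic-mono {0} {B} z≤n
    648β≥0 : 0ℚ ≤ ℕtoℚ 648 * β
    648β≥0 = *-nonneg (0≤ℕtoℚ 648) (0≤inv B)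
    lem : ∀ l u β b lb ε N →
      (l * l * (u * l * β * (u * l * β)) * b + (ℤ.+ 648 / 1) * β * (1ℚ + lb)) + (β + ε * ((ℤ.+ 648 / 1) * β) * N) ≡
      (u * u * (l * (l * (l * (l * 1ℚ)))) * (b * β) + (ℤ.+ 648 / 1) * (1ℚ + lb) + 1ℚ + (ℤ.+ 648 / 1) * ε * N) * β
    lem = solve-∀ ℚ-ring

  -- The terms collected in `R` carry no factor `N` and gain one from log n ≤ 2N. The `ε` term
  -- already has its `N`, so there log n must instead be absorbed by `ε`. What is left over uses ℓ⁴
  -- ≥ 1.
  bound : expWeightedErr 1 cτ n B * (b * F) ≤ C₀ * (lb + λ⁴) * N
  bound = begin
    expWeightedErr 1 cτ n B * (b * F)
      ≤⟨ *-monoʳ (*-nonneg (0≤ℕtoℚ B) F≥0) loss≤ ⟩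
    (R + ℕtoℚ 648 * ε * N) * β * (b * F)
      ≡⟨ lem₁ R ε N β b F ⟩
    (b * β) * (R * F + ℕtoℚ 648 * N * (F * ε))
      ≡⟨ trans (cong (_* (R * F + ℕtoℚ 648 * N * (F * ε))) bβ≡1) (*-identityˡ _) ⟩
    R * F + ℕtoℚ 648 * N * (F * ε)
      ≤⟨ +-mono-≤ (*-monoˡ R≥0 (log≤2totalN n {{n≢0}})) (*-monoˡ (*-nonneg (0≤ℕtoℚ 648) N≥0) Fε≤2) ⟩
    R * (ℕtoℚ 2 * N) + ℕtoℚ 648 * N * ℕtoℚ 2
      ≤⟨ ≤-by (*-nonneg (+-nonneg (*-nonneg (+-nonneg (*-nonneg (0≤ℕtoℚ 2) (sq-nonneg u₀)) (0≤ℕtoℚ 1298)) (0≤ℕtoℚ ⌊log₂ B ⌋))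
                                  (*-nonneg (0≤ℕtoℚ 2594) (0≤q-p λ⁴≥1))) N≥0)
           (lem₂ u₀ λ⁴ lb N) ⟩
    C₀ * (lb + λ⁴) * N ∎
    where
    open ≤-Reasoning
    F≥0 : 0ℚ ≤ F
    F≥0 = 0≤ℕtoℚ L
    R≥0 : 0ℚ ≤ R
    R≥0 = +-nonneg (+-nonneg (*-nonneg (sq-nonneg u₀) (≤-trans 0≤1 λ⁴≥1))
      (*-nonneg (0≤ℕtoℚ 648) (+-nonneg 0≤1 (0≤ℕtoℚ ⌊log₂ B ⌋)))) 0≤1
    lem₁ : ∀ R ε N β b F →
      (R + (ℤ.+ 648 / 1) * ε * N) * β * (b * F) ≡ (b * β) * (R * F + (ℤ.+ 648 / 1) * N * (F * ε))
    lem₁ = solve-∀ ℚ-ring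
    lem₂ : ∀ u l lb N →
      ((ℤ.+ 2 / 1) * (u * u) + (ℤ.+ 2594 / 1)) * (lb + l) * N ≡
      ((u * u * l + (ℤ.+ 648 / 1) * (1ℚ + lb) + 1ℚ) * ((ℤ.+ 2 / 1) * N) + (ℤ.+ 648 / 1) * N * (ℤ.+ 2 / 1)) +
      (((ℤ.+ 2 / 1) * (u * u) + (ℤ.+ 1298 / 1)) * lb + (ℤ.+ 2594 / 1) * (l - 1ℚ)) * N
    lem₂ = solve-∀ ℚ-ring

theorem1 : Σ ℕ λ cT → (1 Data.Nat.≤ cT) × (Σ ℚ λ cτ → (0ℚ Data.Rational.< cτ) ×
    (Σ ℚ λ C → Σ ℕ λ p → Σ ℕ λ n₀ →
    (n : ℕ) → n₀ Data.Nat.≤ n → (B : ℕ) → ⌈log₂ n ⌉ Data.Nat.≤ B → .{{_ : NonZero B}} →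
    expWeightedErr cT cτ n B * (ℕtoℚ B * ℕtoℚ ⌊log₂ n ⌋)
    Data.Rational.≤ C * (ℕtoℚ ⌊log₂ B ⌋ + ℕtoℚ (lglg n ^ p)) * totalN n))
-- The exponent 4 is made of ℓ² from the pairs of tables and ℓ² from the two factors τ + e_a, each
-- of mean O(ℓ/B).
theorem1 = 1 , s≤s z≤n , ℕtoℚ 19441 , positive⁻¹ (ℕtoℚ 19441) ,
  ℕtoℚ 2 * ((ℕtoℚ 19441 + ℕtoℚ 1296) * (ℕtoℚ 19441 + ℕtoℚ 1296)) + ℕtoℚ 2594 , 4 , 2 ^ 64 ,
  λ n n≥2^64 B B≥log → Bound.bound n B n≥2^64 B≥log
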